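{- Let $a_1/b_1$ and $a_2/b_2$ be a Farey pair with $b_1>b_2$. Let $i_{max}$ and $i$ be positive integers with $i<i_{max}$, let $N=b_1\,\mathrm{lcm}(1,2,\dots,i_{max})$, and let $q$ be an integer with $$\frac{N}{b_1(i+1)}<q\le\frac{N}{b_1i}.$$ Then: (1) If $b_1>1$, $$I_N\left(\frac{a_1q+a_2}{b_1q+b_2}\right)=I_N\left(\frac{a_1}{b_1}\right)+s\left(\frac{N}{b_1}\sum_{j=1}^{i}\frac{\varphi(j)}{j}-q\,\Phi(i)\right)+O(i^2),$$ with $s=+1$ when $a_1/b_1<a_2/b_2$ and $s=-1$ otherwise. (2) If $a_1/b_1=0/1$ and $a_2/b_2=1/0$, $$I_N\left(\frac1q\right)=2+N\sum_{j=1}^{i}\frac{\varphi(j)}{j}-q\,\Phi(i).$$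
   Context: For a positive integer $N$, the Farey sequence $F_N$ is the ascending sequence of irreducible fractions in $[0,1]$ (including $0/1$ and $1/1$) whose denominators do not exceed $N$. Fractions $a_1/b_1$, $a_2/b_2$ are written in lowest terms with nonnegative numerator and positive denominator (except for $1/0$ below). $I_N(x)$ is the position that $x$ occupies in $F_N$ (positions starting at $1$, so $I_N(0/1)=1$); equivalently $I_N(x)$ is the number of fractions of $F_N$ in $[0,x]$, and this is used as the definition for all $x \in [0,1]$. Two elements $a_1/b_1$ and $a_2/b_2$ of a Farey sequence form a Farey pair if $|a_1b_2-a_2b_1|=1$. Exceptionally, $0/1$ and $1/0$ are also allowed to form a Farey pair (with $a_1/b_1=0/1$, $a_2/b_2=1/0$); this is the only case in which $b_2=0$. $\varphi$ is Euler's totient function and $\Phi(i)=\sum_{j=1}^{i}\varphi(j)$ is the summatory totient function. The implied constant in $O(i^2)$ is absolute. -}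

module Defs where

open import Data.Bool.Base using (if_then_else_)
open import Data.Integer.Base as ℤ using (+_)
open import Data.List.Base using (List; length; map; filter; concatMap; upTo; applyUpTo)
open import Data.List.Membership.Propositional using (_∈_)
open import Data.Nat.Base using (ℕ; zero; suc; NonZero; _+_; _*_; ∣_-_∣)
open import Data.Nat.Coprimality using (Coprime; coprime?)
open import Data.Nat.LCM using (lcm)
open import Data.Nat.Properties using (_<?_)
open import Data.Rational.Base as ℚ using (ℚ; _/_)
import Data.Rational.Properties as ℚ
open import Data.List.Sort ℚ.≤-decTotalOrder using (sort)
open import Relation.Binary.PropositionalEquality using (_≡_)
open import Relation.Nullary.Decidable using (does)

m*n+k≢0 : ∀ m n k .{{_ : NonZero m}} .{{_ : NonZero n}} → NonZero (m * n + k)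
m*n+k≢0 (suc m) (suc n) k = _

ℕ→ℚ : ℕ → ℚ
ℕ→ℚ n = + n / 1

[1⋯_] : ℕ → List ℕ
[1⋯ n ] = applyUpTo suc n

-- Each element of [0,1] with denominator at most N is produced exactly once,
-- from its numerator and denominator in lowest terms.
Farey : ℕ → List ℚ
Farey N = sort (concatMap withDenominator (upTo N))
  where
  withDenominator : ℕ → List ℚ
  withDenominator k =
    map (λ a → + a / suc k) (filter (λ a → coprime? a (suc k)) (upTo (suc (suc k))))

-- Elements of Farey N are non-negative, so those in [0,x] are those ≤ x.
I : ℕ → ℚ → ℕ
I N x = length (filter (ℚ._≤? x) (Farey N))

-- FareyPair a₁ b₁ a₂ b₂ concerns the fractions a₁/b₁ and a₂/b₂.  They are given
-- by numerator and denominator because 1/0 is allowed and is not in ℚ.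
data FareyPair : (a₁ b₁ a₂ b₂ : ℕ) → Set where
  regular : ∀ {a₁ b₁ a₂ b₂} .{{_ : NonZero b₁}} .{{_ : NonZero b₂}} (M : ℕ) →
            Coprime a₁ b₁ → Coprime a₂ b₂ →
            (+ a₁ / b₁) ∈ Farey M → (+ a₂ / b₂) ∈ Farey M →
            ∣ a₁ * b₂ - a₂ * b₁ ∣ ≡ 1 →
            FareyPair a₁ b₁ a₂ b₂
  exceptional : FareyPair 0 1 1 0

-- The comparison a₁/b₁ < a₂/b₂ is cross-multiplied, as in the definition of
-- < on ℚ, so that it does not require b₂ to be non-zero.
sign : (a₁ b₁ a₂ b₂ : ℕ) → ℚ
sign a₁ b₁ a₂ b₂ = if does (a₁ * b₂ <? a₂ * b₁) then ℚ.1ℚ else ℚ.- ℚ.1ℚ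

φ : ℕ → ℕ
φ n = length (filter (λ k → coprime? k n) [1⋯ n ])

Φ : ℕ → ℕ
Φ zero    = 0
Φ (suc i) = Φ i + φ (suc i)

-- ∑φ/j i is the sum of φ(j)/j over 1 ≤ j ≤ i.
∑φ/j : ℕ → ℚ
∑φ/j zero    = ℚ.0ℚ
∑φ/j (suc i) = ∑φ/j i ℚ.+ + φ (suc i) / suc i

lcmUpTo : ℕ → ℕ
lcmUpTo zero    = 1
lcmUpTo (suc n) = lcm (lcmUpTo n) (suc n)

{-# OPTIONS --safe #-}
module Submission where

-- Put L = lcm(1,…,iₘₐₓ), so N = b₁L.  The unimodular substitution
-- h = a₁u + a₂v, k = b₁u + b₂v maps coprime (u,v) to reduced fractions h/k, and
-- h/k lies between a₁/b₁ and (a₁q+a₂)/(b₁q+b₂) exactly when u ≥ qv (u > qv if the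
-- latter end is excluded).  The condition k ≤ N becomes u ≤ L - b₂v/b₁, which
-- together with L < q(i+1) forces v ≤ i.  As v divides L, the interval (qv, L]
-- contains exactly (L/v)φ(v) - qφ(v) integers coprime to v, and since b₂ ≤ b₁ at most
-- v of them violate k ≤ N.  Summing over v ≤ i gives an error of at most i²; it
-- vanishes, up to the boundary point (u,v) = (q,1), when b₂ = 0.

open import Defs
open import Data.Bool.Base using (if_then_else_; true; false)
open import Data.Integer.Base as ℤ using (+_)
import Data.Integer.Properties as ℤ
open import Data.List.Base
  using (List; []; _∷_; _++_; length; map; filter; concatMap; applyUpTo; upTo; cartesianProduct)
open import Data.List.Membership.Propositional using (_∈_)
open import Data.List.Membership.Propositional.Properties
  using (∈-map∘filter⁺; ∈-map∘filter⁻; ∈-filter⁺; ∈-filter⁻; ∈-cartesianProduct⁺; ∈-cartesianProduct⁻;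
         ∈-upTo⁺; ∈-upTo⁻; ∈-concatMap⁻)
open import Data.List.Membership.Propositional.Properties.WithK using (unique∧set⇒bag)
open import Data.List.Properties using (length-++; length-map; filter-++)
open import Data.List.Relation.Binary.BagAndSetEquality using (∼bag⇒↭)
open import Data.List.Relation.Binary.Permutation.Propositional.Properties using (↭-length; filter-↭; ∈-resp-↭)
open import Data.List.Relation.Unary.Any using (satisfied)
open import Data.List.Relation.Unary.Unique.Propositional using (Unique)
import Data.List.Relation.Unary.Unique.Propositional.Properties as Unique
open import Data.Nat.Base using (ℕ; zero; suc; z≤n; s≤s; NonZero)
open import Data.Nat.Base as ℕ using ()
open import Data.Nat.Coprimality as Coprimality using (Coprime; coprime?; coprime-+)
open import Data.Nat.Divisibility
  using (_∣_; divides; ∣-trans; ∣m∣n⇒∣m+n; ∣m+n∣m⇒∣n; ∣n⇒∣m*n; ∣m⇒∣m*n)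
import Data.Nat.DivMod as ℕ
open import Data.Nat.LCM using (m∣lcm[m,n]; n∣lcm[m,n])
import Data.Nat.Properties as ℕ
open import Algebra.Properties.CommutativeSemigroup ℕ.+-commutativeSemigroup using (interchange)
open import Data.Nat.Properties using (m*n≢0)
open import Data.Nat.Tactic.RingSolver using (solve-∀)
open import Data.Product.Base using (∃-syntax; _×_; _,_; proj₁; proj₂)
open import Data.Rational.Base
  using (ℚ; _/_; _+_; _-_; _*_; _≤_; _<_; ∣_∣; toℚᵘ; fromℚᵘ; 1ℚ; -_)
import Data.Rational.Base as ℚ
import Data.Rational.Properties as ℚ
open import Data.List.Sort ℚ.≤-decTotalOrder using (sort-↭)
open import Data.Rational.Solver using (module +-*-Solver)
open import Data.Rational.Unnormalised.Base as ℚᵘ using (mkℚᵘ; *≡*)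
import Data.Rational.Unnormalised.Properties as ℚᵘ
open import Data.Sum.Base using (_⊎_; inj₁; inj₂; [_,_]′)
open import Function.Base using (_∘_; id)
open import Function.Bundles using (mk⇔)
open import Level using (Level)
open import Relation.Binary.PropositionalEquality
  using (_≡_; refl; sym; trans; cong; cong₂; subst; subst₂; module ≡-Reasoning)
open import Relation.Nullary.Decidable using (Dec; yes; no; does; _×-dec_; ¬?; dec-true; dec-false)
open import Relation.Nullary.Negation using (¬_; contradiction)
open import Relation.Unary using (Pred; Decidable)


-- Finite sums and counting

-- Write x for (a₁q+a₂)/(b₁q+b₂). To the right of a₁/b₁ the fractions counted lie in (a₁/b₁, x], to
-- the left in (x, a₁/b₁]. So on the right x = (q,1) is counted and a₁/b₁ = (1,0) is not, and on the
-- left it is the reverse; the parameter `t` and the condition 1 ≤ v + t encode this. The left side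
-- shares the algebra of the right: exchanging numerators and denominators reverses the order and
-- makes the determinant +1 again. Identities stay in ℕ, with negative terms moved across, and only
-- the finished balance is carried to ℚ. It gives the error exactly as δ - E on the right and -(δ -
-- E) on the left, where E counts the lattice points with u ≤ L but k > N and δ ≤ 1 is the boundary
-- point. Since E and δ both lie between 0 and i², so does the absolute value of their difference,
-- whence C = 1. The pair 0/1, 1/0 goes through the same counting lemmas, because they ask for a₁ +
-- a₂ ≤ b₁ + b₂ and not for a₂ ≤ b₂.

∑ : ℕ → (ℕ → ℕ) → ℕ
∑ zero    f = 0
∑ (suc n) f = ∑ n f ℕ.+ f n

∑-cong : ∀ n {f g : ℕ → ℕ} → (∀ {k} → k ℕ.< n → f k ≡ g k) → ∑ n f ≡ ∑ n g
∑-cong zero    f≡g = refl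
∑-cong (suc n) f≡g = cong₂ ℕ._+_ (∑-cong n (f≡g ∘ ℕ.m<n⇒m<1+n)) (f≡g (ℕ.n<1+n n))

∑-mono-≤ : ∀ n {f g : ℕ → ℕ} → (∀ {k} → k ℕ.< n → f k ℕ.≤ g k) → ∑ n f ℕ.≤ ∑ n g
∑-mono-≤ zero    f≤g = z≤n
∑-mono-≤ (suc n) f≤g = ℕ.+-mono-≤ (∑-mono-≤ n (f≤g ∘ ℕ.m<n⇒m<1+n)) (f≤g (ℕ.n<1+n n))

∑-const : ∀ n c → ∑ n (λ _ → c) ≡ n ℕ.* c
∑-const zero    c = refl
∑-const (suc n) c = trans (cong (ℕ._+ c) (∑-const n c)) (ℕ.+-comm (n ℕ.* c) c)

∑-zero : ∀ n {f : ℕ → ℕ} → (∀ {k} → k ℕ.< n → f k ≡ 0) → ∑ n f ≡ 0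
∑-zero n f≡0 = trans (∑-cong n f≡0) (trans (∑-const n 0) (ℕ.*-zeroʳ n))

∑-+ : ∀ n (f g : ℕ → ℕ) → ∑ n (λ k → f k ℕ.+ g k) ≡ ∑ n f ℕ.+ ∑ n g
∑-+ zero    f g = refl
∑-+ (suc n) f g = trans (cong (ℕ._+ (f n ℕ.+ g n)) (∑-+ n f g)) (interchange (∑ n f) (∑ n g) (f n) (g n))

∑-*ˡ : ∀ n c (f : ℕ → ℕ) → ∑ n (λ k → c ℕ.* f k) ≡ c ℕ.* ∑ n f
∑-*ˡ zero    c f = sym (ℕ.*-zeroʳ c)
∑-*ˡ (suc n) c f = trans (cong (ℕ._+ c ℕ.* f n) (∑-*ˡ n c f)) (sym (ℕ.*-distribˡ-+ c (∑ n f) (f n)))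

∑-head : ∀ n (f : ℕ → ℕ) → ∑ (suc n) f ≡ f 0 ℕ.+ ∑ n (f ∘ suc)
∑-head zero    f = ℕ.+-comm 0 (f 0)
∑-head (suc n) f = trans (cong (ℕ._+ f (suc n)) (∑-head n f)) (ℕ.+-assoc (f 0) _ _)

∑-split : ∀ m n (f : ℕ → ℕ) → ∑ (m ℕ.+ n) f ≡ ∑ m f ℕ.+ ∑ n (λ k → f (m ℕ.+ k))
∑-split m zero    f = trans (cong (λ l → ∑ l f) (ℕ.+-identityʳ m)) (sym (ℕ.+-identityʳ _))
∑-split m (suc n) f =
  trans (cong (λ l → ∑ l f) (ℕ.+-suc m n))
 (trans (cong (ℕ._+ f (m ℕ.+ n)) (∑-split m n f)) (ℕ.+-assoc (∑ m f) _ _))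

private
  variable
    a b p q : Level
    A : Set a
    B : Set b

χ : {P : Set p} → Dec P → ℕ
χ P? = if does P? then 1 else 0

χ-yes : {P : Set p} (P? : Dec P) → P → χ P? ≡ 1
χ-yes (yes _) _  = refl
χ-yes (no ¬p) p = contradiction p ¬p

χ-no : {P : Set p} (P? : Dec P) → ¬ P → χ P? ≡ 0
χ-no (yes p) ¬p = contradiction p ¬p
χ-no (no _)  _   = refl

χ≤1 : {P : Set p} (P? : Dec P) → χ P? ℕ.≤ 1
χ≤1 (yes _) = s≤s z≤n
χ≤1 (no _)  = z≤n

χ-cong : {P : Set p} {Q : Set q} (P? : Dec P) (Q? : Dec Q) → (P → Q) → (Q → P) → χ P? ≡ χ Q?
χ-cong (yes p) Q? to from = sym (χ-yes Q? (to p))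
χ-cong (no ¬p) Q? to from = sym (χ-no Q? (¬p ∘ from))

χ-split : {P : Set p} {Q : Set q} (P? : Dec P) (Q? : Dec Q) →
          χ P? ≡ χ (P? ×-dec Q?) ℕ.+ χ (P? ×-dec ¬? Q?)
χ-split (yes _) (yes _) = refl
χ-split (yes _) (no _)  = refl
χ-split (no _)  _       = refl

count : {P : Pred A p} → Decidable P → List A → ℕ
count P? xs = length (filter P? xs)

count-∷ : {P : Pred A p} (P? : Decidable P) (x : A) (xs : List A) →
          count P? (x ∷ xs) ≡ χ (P? x) ℕ.+ count P? xs
count-∷ P? x xs with does (P? x)
... | true  = refl
... | false = refl

count-++ : {P : Pred A p} (P? : Decidable P) (xs ys : List A) →
           count P? (xs ++ ys) ≡ count P? xs ℕ.+ count P? ys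
count-++ P? xs ys = trans (cong length (filter-++ P? xs ys)) (length-++ (filter P? xs))

count-map : {P : Pred B p} (P? : Decidable P) (f : A → B) (xs : List A) →
            count P? (map f xs) ≡ count (P? ∘ f) xs
count-map P? f []       = refl
count-map P? f (x ∷ xs) =
  trans (count-∷ P? (f x) (map f xs))
 (trans (cong (χ (P? (f x)) ℕ.+_) (count-map P? f xs)) (sym (count-∷ (P? ∘ f) x xs)))

count-filter : {P : Pred A p} {Q : Pred A q} (P? : Decidable P) (Q? : Decidable Q) (xs : List A) →
               count Q? (filter P? xs) ≡ count (λ x → P? x ×-dec Q? x) xs
count-filter P? Q? []       = refl
count-filter P? Q? (x ∷ xs) with does (P? x)
... | false = count-filter P? Q? xs
... | true with does (Q? x)
...   | true  = cong suc (count-filter P? Q? xs)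
...   | false = count-filter P? Q? xs

count-applyUpTo : {P : Pred A p} (P? : Decidable P) (f : ℕ → A) (n : ℕ) →
                  count P? (applyUpTo f n) ≡ ∑ n (λ k → χ (P? (f k)))
count-applyUpTo P? f zero    = refl
count-applyUpTo P? f (suc n) =
  trans (count-∷ P? (f 0) (applyUpTo (f ∘ suc) n))
 (trans (cong (χ (P? (f 0)) ℕ.+_) (count-applyUpTo P? (f ∘ suc) n)) (sym (∑-head n _)))

count-concatMap : {P : Pred B p} (P? : Decidable P) (g : A → List B) (f : ℕ → A) (n : ℕ) →
                  count P? (concatMap g (applyUpTo f n)) ≡ ∑ n (λ k → count P? (g (f k)))
count-concatMap P? g f zero    = refl
count-concatMap P? g f (suc n) =
  trans (count-++ P? (g (f 0)) (concatMap g (applyUpTo (f ∘ suc) n)))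
 (trans (cong (count P? (g (f 0)) ℕ.+_) (count-concatMap P? g (f ∘ suc) n)) (sym (∑-head n _)))

grid : ℕ → ℕ → List (ℕ × ℕ)
grid m n = cartesianProduct (upTo m) (upTo n)

count-grid : {P : Pred (ℕ × ℕ) p} (P? : Decidable P) (m n : ℕ) →
             count P? (grid m n) ≡ ∑ m (λ x → ∑ n (λ y → χ (P? (x , y))))
count-grid P? m n = go id m
  where
  go : ∀ f m → count P? (cartesianProduct (applyUpTo f m) (upTo n)) ≡
               ∑ m (λ x → ∑ n (λ y → χ (P? (f x , y))))
  go f zero    = refl
  go f (suc m) =
    trans (count-++ P? (map (f 0 ,_) (upTo n)) (cartesianProduct (applyUpTo (f ∘ suc) m) (upTo n)))
   (trans (cong₂ ℕ._+_ (trans (count-map P? (f 0 ,_) (upTo n)) (count-applyUpTo _ id n)) (go (f ∘ suc) m))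
          (sym (∑-head m _)))

count-difference : {P : Pred A p} {Q : Pred A q} (P? : Decidable P) (Q? : Decidable Q) →
                   (∀ x → P x → Q x) → ∀ xs →
                   count Q? xs ≡ count P? xs ℕ.+ count (λ x → Q? x ×-dec ¬? (P? x)) xs
count-difference P? Q? P⊆Q []       = refl
count-difference P? Q? P⊆Q (x ∷ xs) = begin
  count Q? (x ∷ xs)
    ≡⟨ count-∷ Q? x xs ⟩
  χ (Q? x) ℕ.+ count Q? xs
    ≡⟨ cong₂ ℕ._+_ (trans (χ-split (Q? x) (P? x)) (cong (ℕ._+ χ (Q∖P? x)) (χ-cong (Q? x ×-dec P? x) (P? x) proj₂ (λ p → P⊆Q x p , p))))
                   (count-difference P? Q? P⊆Q xs) ⟩
  (χ (P? x) ℕ.+ χ (Q∖P? x)) ℕ.+ (count P? xs ℕ.+ count Q∖P? xs)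
    ≡⟨ interchange (χ (P? x)) (χ (Q∖P? x)) (count P? xs) (count Q∖P? xs) ⟩
  (χ (P? x) ℕ.+ count P? xs) ℕ.+ (χ (Q∖P? x) ℕ.+ count Q∖P? xs)
    ≡⟨ cong₂ ℕ._+_ (count-∷ P? x xs) (count-∷ Q∖P? x xs) ⟨
  count P? (x ∷ xs) ℕ.+ count Q∖P? (x ∷ xs) ∎
  where
  open ≡-Reasoning
  Q∖P? = λ y → Q? y ×-dec ¬? (P? y)

-- Duplicate-free lists with the same elements are permutations of each other, so the image of the
-- first filtered list under the injection and the second filtered list have equal length.
count-bijection : {P : Pred A p} {Q : Pred B q} (P? : Decidable P) (Q? : Decidable Q)
                  {xs : List A} {ys : List B} → Unique xs → Unique ys →
                  (f : A → B) → (∀ {x y} → f x ≡ f y → x ≡ y) →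
                  (∀ {x} → x ∈ xs → P x → f x ∈ ys × Q (f x)) →
                  (∀ {y} → y ∈ ys → Q y → ∃[ x ] x ∈ xs × y ≡ f x × P x) →
                  count P? xs ≡ count Q? ys
count-bijection P? Q? {xs} {ys} xs! ys! f f-injective to from =
  trans (sym (length-map f (filter P? xs)))
        (↭-length (∼bag⇒↭ (unique∧set⇒bag
          (Unique.map⁺ f-injective (Unique.filter⁺ P? xs!)) (Unique.filter⁺ Q? ys!)
          (mk⇔ forth back))))
  where
  forth : ∀ {y} → y ∈ map f (filter P? xs) → y ∈ filter Q? ys
  forth y∈ with x , x∈xs , refl , px ← ∈-map∘filter⁻ f P? y∈ =
    let fx∈ys , qfx = to x∈xs px in ∈-filter⁺ Q? fx∈ys qfx
  back : ∀ {y} → y ∈ filter Q? ys → y ∈ map f (filter P? xs)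
  back y∈ = let y∈ys , qy = ∈-filter⁻ Q? y∈ in ∈-map∘filter⁺ f P? (from y∈ys qy)

-- Farey positions as counts of lattice points

-- `_/_` reduces to lowest terms and so hides the given numerator and denominator. In ℚᵘ they
-- survive, and there the order is a comparison of cross products.
/-cancel-≤ : ∀ a b c d .{{_ : NonZero b}} .{{_ : NonZero d}} →
             (+ a / b) ℚ.≤ (+ c / d) → a ℕ.* d ℕ.≤ c ℕ.* b
/-cancel-≤ a b@(suc b-1) c d@(suc d-1) a/b≤c/d =
  ℤ.drop‿+≤+ (subst₂ ℤ._≤_ (sym (ℤ.pos-* a d)) (sym (ℤ.pos-* c b)) (ℚᵘ.drop-*≤* a/b≤ᵘc/d))
  where
  a/b≤ᵘc/d : mkℚᵘ (+ a) b-1 ℚᵘ.≤ mkℚᵘ (+ c) d-1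
  a/b≤ᵘc/d = ℚᵘ.≤-respˡ-≃ (ℚ.toℚᵘ-fromℚᵘ (mkℚᵘ (+ a) b-1))
            (ℚᵘ.≤-respʳ-≃ (ℚ.toℚᵘ-fromℚᵘ (mkℚᵘ (+ c) d-1)) (ℚ.toℚᵘ-mono-≤ a/b≤c/d))

/-mono-≤ : ∀ a b c d .{{_ : NonZero b}} .{{_ : NonZero d}} →
           a ℕ.* d ℕ.≤ c ℕ.* b → (+ a / b) ℚ.≤ (+ c / d)
/-mono-≤ a b@(suc b-1) c d@(suc d-1) ad≤cb =
  ℚ.toℚᵘ-cancel-≤
    (ℚᵘ.≤-respˡ-≃ (ℚᵘ.≃-sym (ℚ.toℚᵘ-fromℚᵘ (mkℚᵘ (+ a) b-1)))
    (ℚᵘ.≤-respʳ-≃ (ℚᵘ.≃-sym (ℚ.toℚᵘ-fromℚᵘ (mkℚᵘ (+ c) d-1)))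
      (ℚᵘ.*≤* (subst₂ ℤ._≤_ (ℤ.pos-* a d) (ℤ.pos-* c b) (ℤ.+≤+ ad≤cb)))))

/-cancel-< : ∀ a b c d .{{_ : NonZero b}} .{{_ : NonZero d}} →
             (+ a / b) ℚ.< (+ c / d) → a ℕ.* d ℕ.< c ℕ.* b
/-cancel-< a b c d a/b<c/d =
  ℕ.≰⇒> (λ cb≤ad → ℚ.<-irrefl refl (ℚ.<-≤-trans a/b<c/d (/-mono-≤ c d a b cb≤ad)))

-- Sorting permutes the list and leaves the count unchanged, so the position of c/d becomes a sum
-- over denominators.
I-∑ : ∀ N c d .{{_ : NonZero d}} →
      I N (+ c / d) ≡
      ∑ N (λ k → ∑ (suc (suc k)) (λ h → χ (coprime? h (suc k) ×-dec h ℕ.* d ℕ.≤? c ℕ.* suc k)))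
I-∑ N c d = trans (↭-length (filter-↭ ≤x? (sort-↭ _))) (trans (count-concatMap ≤x? _ id N) (∑-cong N slice))
  where
  x = + c / d
  ≤x? = ℚ._≤? x
  slice : ∀ {k} → k ℕ.< N → _
  slice {k} _ =
    trans (count-map ≤x? (λ h → + h / suc k) (filter coprime-k? (upTo (suc (suc k)))))
   (trans (count-filter coprime-k? (λ h → ≤x? (+ h / suc k)) (upTo (suc (suc k))))
   (trans (count-applyUpTo (λ h → coprime-k? h ×-dec ≤x? (+ h / suc k)) id (suc (suc k)))
          (∑-cong (suc (suc k)) (λ {h} _ →
            χ-cong (coprime-k? h ×-dec ≤x? (+ h / suc k)) (coprime-k? h ×-dec h ℕ.* d ℕ.≤? c ℕ.* suc k)
              (λ (cop , h/k≤x) → (λ {g} → cop {g}) , /-cancel-≤ h (suc k) c d h/k≤x)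
              (λ (cop , hd≤ck) → (λ {g} → cop {g}) , /-mono-≤ h (suc k) c d hd≤ck)))))
    where
    coprime-k? : Decidable (λ h → Coprime h (suc k))
    coprime-k? h = coprime? h (suc k)

-- Pairs are ordered (denominator , numerator).
Reduced : ℕ × ℕ → Set
Reduced (k , h) = (0 ℕ.< k × h ℕ.≤ k) × Coprime h k

reduced? : Decidable Reduced
reduced? (k , h) = (0 ℕ.<? k ×-dec h ℕ.≤? k) ×-dec coprime? h k

_≼_/_ : ℕ × ℕ → ℕ → ℕ → Set
(k , h) ≼ c / d = Reduced (k , h) × h ℕ.* d ℕ.≤ c ℕ.* k

≼? : ∀ c d → Decidable (_≼ c / d)
≼? c d (k , h) = reduced? (k , h) ×-dec h ℕ.* d ℕ.≤? c ℕ.* k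

-- A square grid, whose rows all have the same length, is a duplicate-free product on which
-- bijections can be set up. The cells it adds, those with k = 0 or h > k, fail `Reduced`.
I-count : ∀ N c d .{{_ : NonZero d}} →
          I N (+ c / d) ≡ count (≼? c d) (grid (suc N) (suc N))
I-count N c d = sym (begin
  count (≼? c d) (grid (suc N) (suc N))
    ≡⟨ count-grid (≼? c d) (suc N) (suc N) ⟩
  ∑ (suc N) (λ k → ∑ (suc N) (λ h → χ (≼? c d (k , h))))
    ≡⟨ ∑-head N _ ⟩
  ∑ (suc N) (λ h → χ (≼? c d (0 , h))) ℕ.+ ∑ N (λ k → ∑ (suc N) (λ h → χ (≼? c d (suc k , h))))
    ≡⟨ cong₂ ℕ._+_ (∑-zero (suc N) (λ {h} _ → χ-no (≼? c d (0 , h)) (λ { (((() , _) , _) , _) })))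
                   (∑-cong N slice) ⟩
  ∑ N (λ k → ∑ (suc (suc k)) (λ h → χ (coprime? h (suc k) ×-dec h ℕ.* d ℕ.≤? c ℕ.* suc k)))
    ≡⟨ I-∑ N c d ⟨
  I N (+ c / d) ∎)
  where
  open ≡-Reasoning
  slice : ∀ {k} → k ℕ.< N →
          ∑ (suc N) (λ h → χ (≼? c d (suc k , h))) ≡
          ∑ (suc (suc k)) (λ h → χ (coprime? h (suc k) ×-dec h ℕ.* d ℕ.≤? c ℕ.* suc k))
  slice {k} k<N = begin
    ∑ (suc N) f
      ≡⟨ cong (λ n → ∑ n f) (ℕ.m+[n∸m]≡n (s≤s k<N)) ⟨
    ∑ (suc (suc k) ℕ.+ (N ℕ.∸ suc k)) f
      ≡⟨ ∑-split (suc (suc k)) (N ℕ.∸ suc k) f ⟩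
    ∑ (suc (suc k)) f ℕ.+ ∑ (N ℕ.∸ suc k) (λ j → f (suc (suc k) ℕ.+ j))
      ≡⟨ cong₂ ℕ._+_
           (∑-cong (suc (suc k)) (λ { {h} (s≤s h≤k) → χ-cong (≼? c d (suc k , h)) (coprime? h (suc k) ×-dec h ℕ.* d ℕ.≤? c ℕ.* suc k)
             (λ ((_ , cop) , le) → (λ {g} → cop {g}) , le)
             (λ (cop , le) → ((s≤s z≤n , h≤k) , (λ {g} → cop {g})) , le) }))
           (∑-zero (N ℕ.∸ suc k) (λ {j} _ → χ-no (≼? c d (suc k , suc (suc k) ℕ.+ j))
             (λ (((_ , h≤k) , _) , _) → ℕ.m+n≮m (suc k) j h≤k))) ⟩
    ∑ (suc (suc k)) _ ℕ.+ 0
      ≡⟨ ℕ.+-identityʳ _ ⟩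
    ∑ (suc (suc k)) _ ∎
    where f = λ h → χ (≼? c d (suc k , h))

-- Counting integers coprime to v

κ : ℕ → ℕ → ℕ
κ v n = ∑ n (λ u → χ (coprime? u v))

coprime-+⁻ : ∀ {u} v → Coprime (v ℕ.+ u) v → Coprime u v
coprime-+⁻ v cop (d∣u , d∣v) = cop (∣m∣n⇒∣m+n d∣v d∣u , d∣v)

coprime?-period : ∀ v u → χ (coprime? (v ℕ.+ u) v) ≡ χ (coprime? u v)
coprime?-period v u = χ-cong (coprime? (v ℕ.+ u) v) (coprime? u v) (coprime-+⁻ v) coprime-+

coprime?-multiple : ∀ v m → χ (coprime? (m ℕ.* v) v) ≡ χ (coprime? 0 v)
coprime?-multiple v zero    = refl
coprime?-multiple v (suc m) = trans (coprime?-period v (m ℕ.* v)) (coprime?-multiple v m)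

-- `κ` runs over 0, ..., v-1 and `φ` over 1, ..., v. As 0 and v are congruent modulo v, they are
-- coprime to v together, and adding their common indicator to either count gives the count over 0,
-- ..., v.
κ-period : ∀ v → κ v v ≡ φ v
κ-period v = ℕ.+-cancelʳ-≡ (χ (coprime? 0 v)) (κ v v) (φ v) (begin
  κ v v ℕ.+ χ (coprime? 0 v)
    ≡⟨ cong (κ v v ℕ.+_) (trans (cong (λ w → χ (coprime? w v)) (sym (ℕ.+-identityʳ v))) (coprime?-period v 0)) ⟨
  κ v (suc v)
    ≡⟨ ∑-head v _ ⟩
  χ (coprime? 0 v) ℕ.+ ∑ v (λ u → χ (coprime? (suc u) v))
    ≡⟨ cong (χ (coprime? 0 v) ℕ.+_) (count-applyUpTo (λ u → coprime? u v) suc v) ⟨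
  χ (coprime? 0 v) ℕ.+ φ v
    ≡⟨ ℕ.+-comm _ (φ v) ⟩
  φ v ℕ.+ χ (coprime? 0 v) ∎)
  where open ≡-Reasoning

κ-multiple : ∀ v m → κ v (m ℕ.* v) ≡ m ℕ.* φ v
κ-multiple v zero    = refl
κ-multiple v (suc m) =
  trans (∑-split v (m ℕ.* v) _)
        (cong₂ ℕ._+_ (κ-period v)
          (trans (∑-cong (m ℕ.* v) (λ {u} _ → coprime?-period v u)) (κ-multiple v m)))

-- The extra argument u = mv has the same gcd with v as 0 has, namely v, so the last summand is 1
-- exactly when v = 1.
κ-suc-multiple : ∀ v m → κ v (suc (m ℕ.* v)) ≡ m ℕ.* φ v ℕ.+ χ (coprime? 0 v)
κ-suc-multiple v m = cong₂ ℕ._+_ (κ-multiple v m) (coprime?-multiple v m)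

-- As gcd(0, v) = v, only v = 1 contributes. This is how the end point (u,v) = (q,1) enters the
-- total over all slices.
∑-coprime-0 : ∀ n .{{_ : NonZero n}} → ∑ n (λ j → χ (coprime? 0 (suc j))) ≡ 1
∑-coprime-0 (suc n) = trans (∑-head n _) (cong suc (∑-zero n (λ {j} _ →
  χ-no (coprime? 0 (suc (suc j))) (λ cop → Coprimality.¬0-coprimeTo-2+ (λ {g} → cop {g})))))

-- Unimodular changes of coordinates

comb : ℕ → ℕ → ℕ → ℕ → ℕ
comb x y u v = x ℕ.* u ℕ.+ y ℕ.* v

comb-coprime⁻ : ∀ x₁ y₁ x₂ y₂ {u v} → Coprime (comb x₁ y₁ u v) (comb x₂ y₂ u v) → Coprime u v
comb-coprime⁻ x₁ y₁ x₂ y₂ cop (d∣u , d∣v) =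
  cop (∣m∣n⇒∣m+n (∣n⇒∣m*n x₁ d∣u) (∣n⇒∣m*n y₁ d∣v) , ∣m∣n⇒∣m+n (∣n⇒∣m*n x₂ d∣u) (∣n⇒∣m*n y₂ d∣v))

module Unimodular (p₁ p₂ r₁ r₂ : ℕ) (det : p₂ ℕ.* r₁ ≡ suc (p₁ ℕ.* r₂)) where

  -- Together with `cross₂` this is the inverse matrix, v = hr₁ - p₁k and u = p₂k - r₂h, written
  -- without subtraction.
  cross₁ : ∀ u v → comb p₁ p₂ u v ℕ.* r₁ ≡ v ℕ.+ p₁ ℕ.* comb r₁ r₂ u v
  cross₁ u v = trans (expand p₁ p₂ r₁ u v)
              (trans (cong (λ x → p₁ ℕ.* (r₁ ℕ.* u) ℕ.+ x ℕ.* v) det) (collect p₁ r₁ r₂ u v))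
    where
    expand : ∀ p₁ p₂ r₁ u v → (p₁ ℕ.* u ℕ.+ p₂ ℕ.* v) ℕ.* r₁ ≡ p₁ ℕ.* (r₁ ℕ.* u) ℕ.+ p₂ ℕ.* r₁ ℕ.* v
    expand = solve-∀
    collect : ∀ p₁ r₁ r₂ u v → p₁ ℕ.* (r₁ ℕ.* u) ℕ.+ suc (p₁ ℕ.* r₂) ℕ.* v ≡ v ℕ.+ p₁ ℕ.* (r₁ ℕ.* u ℕ.+ r₂ ℕ.* v)
    collect = solve-∀

  cross₂ : ∀ u v → p₂ ℕ.* comb r₁ r₂ u v ≡ u ℕ.+ r₂ ℕ.* comb p₁ p₂ u v
  cross₂ u v = trans (expand p₂ r₁ r₂ u v)
              (trans (cong (λ x → x ℕ.* u ℕ.+ p₂ ℕ.* (r₂ ℕ.* v)) det) (collect p₁ p₂ r₂ u v))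
    where
    expand : ∀ p₂ r₁ r₂ u v → p₂ ℕ.* (r₁ ℕ.* u ℕ.+ r₂ ℕ.* v) ≡ p₂ ℕ.* r₁ ℕ.* u ℕ.+ p₂ ℕ.* (r₂ ℕ.* v)
    expand = solve-∀
    collect : ∀ p₁ p₂ r₂ u v → suc (p₁ ℕ.* r₂) ℕ.* u ℕ.+ p₂ ℕ.* (r₂ ℕ.* v) ≡ u ℕ.+ r₂ ℕ.* (p₁ ℕ.* u ℕ.+ p₂ ℕ.* v)
    collect = solve-∀

  coordinates : ∀ {h k u v} → h ℕ.* r₁ ≡ v ℕ.+ p₁ ℕ.* k → p₂ ℕ.* k ≡ u ℕ.+ r₂ ℕ.* h →
                h ≡ comb p₁ p₂ u v × k ≡ comb r₁ r₂ u v
  coordinates {h} {k} {u} {v} eq₁ eq₂ =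
    ℕ.+-cancelʳ-≡ (p₁ ℕ.* (r₂ ℕ.* h) ℕ.+ p₂ ℕ.* (p₁ ℕ.* k)) h (comb p₁ p₂ u v) (begin
      h ℕ.+ (p₁ ℕ.* (r₂ ℕ.* h) ℕ.+ p₂ ℕ.* (p₁ ℕ.* k))     ≡⟨ expandₕ p₁ p₂ r₂ h k ⟩
      p₁ ℕ.* (p₂ ℕ.* k) ℕ.+ suc (p₁ ℕ.* r₂) ℕ.* h         ≡⟨ cong (λ x → p₁ ℕ.* (p₂ ℕ.* k) ℕ.+ x ℕ.* h) det ⟨
      p₁ ℕ.* (p₂ ℕ.* k) ℕ.+ p₂ ℕ.* r₁ ℕ.* h               ≡⟨ cong (p₁ ℕ.* (p₂ ℕ.* k) ℕ.+_) (regroup p₂ r₁ h) ⟩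
      p₁ ℕ.* (p₂ ℕ.* k) ℕ.+ p₂ ℕ.* (h ℕ.* r₁)             ≡⟨ cong₂ (λ x y → p₁ ℕ.* x ℕ.+ p₂ ℕ.* y) eq₂ eq₁ ⟩
      p₁ ℕ.* (u ℕ.+ r₂ ℕ.* h) ℕ.+ p₂ ℕ.* (v ℕ.+ p₁ ℕ.* k) ≡⟨ collectₕ p₁ p₂ r₂ h k u v ⟩
      comb p₁ p₂ u v ℕ.+ (p₁ ℕ.* (r₂ ℕ.* h) ℕ.+ p₂ ℕ.* (p₁ ℕ.* k)) ∎) ,
    ℕ.+-cancelʳ-≡ (r₁ ℕ.* (r₂ ℕ.* h) ℕ.+ r₂ ℕ.* (p₁ ℕ.* k)) k (comb r₁ r₂ u v) (begin
      k ℕ.+ (r₁ ℕ.* (r₂ ℕ.* h) ℕ.+ r₂ ℕ.* (p₁ ℕ.* k))     ≡⟨ expandₖ p₁ r₁ r₂ h k ⟩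
      suc (p₁ ℕ.* r₂) ℕ.* k ℕ.+ r₂ ℕ.* (h ℕ.* r₁)         ≡⟨ cong (λ x → x ℕ.* k ℕ.+ r₂ ℕ.* (h ℕ.* r₁)) det ⟨
      p₂ ℕ.* r₁ ℕ.* k ℕ.+ r₂ ℕ.* (h ℕ.* r₁)               ≡⟨ cong (ℕ._+ r₂ ℕ.* (h ℕ.* r₁)) (regroup′ p₂ r₁ k) ⟩
      r₁ ℕ.* (p₂ ℕ.* k) ℕ.+ r₂ ℕ.* (h ℕ.* r₁)             ≡⟨ cong₂ (λ x y → r₁ ℕ.* x ℕ.+ r₂ ℕ.* y) eq₂ eq₁ ⟩
      r₁ ℕ.* (u ℕ.+ r₂ ℕ.* h) ℕ.+ r₂ ℕ.* (v ℕ.+ p₁ ℕ.* k) ≡⟨ collectₖ p₁ r₁ r₂ h k u v ⟩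
      comb r₁ r₂ u v ℕ.+ (r₁ ℕ.* (r₂ ℕ.* h) ℕ.+ r₂ ℕ.* (p₁ ℕ.* k)) ∎)
    where
    open ≡-Reasoning
    expandₕ : ∀ p₁ p₂ r₂ h k → h ℕ.+ (p₁ ℕ.* (r₂ ℕ.* h) ℕ.+ p₂ ℕ.* (p₁ ℕ.* k)) ≡ p₁ ℕ.* (p₂ ℕ.* k) ℕ.+ suc (p₁ ℕ.* r₂) ℕ.* h
    expandₕ = solve-∀
    regroup : ∀ p₂ r₁ h → p₂ ℕ.* r₁ ℕ.* h ≡ p₂ ℕ.* (h ℕ.* r₁)
    regroup = solve-∀
    collectₕ : ∀ p₁ p₂ r₂ h k u v → p₁ ℕ.* (u ℕ.+ r₂ ℕ.* h) ℕ.+ p₂ ℕ.* (v ℕ.+ p₁ ℕ.* k) ≡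
               p₁ ℕ.* u ℕ.+ p₂ ℕ.* v ℕ.+ (p₁ ℕ.* (r₂ ℕ.* h) ℕ.+ p₂ ℕ.* (p₁ ℕ.* k))
    collectₕ = solve-∀
    expandₖ : ∀ p₁ r₁ r₂ h k → k ℕ.+ (r₁ ℕ.* (r₂ ℕ.* h) ℕ.+ r₂ ℕ.* (p₁ ℕ.* k)) ≡ suc (p₁ ℕ.* r₂) ℕ.* k ℕ.+ r₂ ℕ.* (h ℕ.* r₁)
    expandₖ = solve-∀
    regroup′ : ∀ p₂ r₁ k → p₂ ℕ.* r₁ ℕ.* k ≡ r₁ ℕ.* (p₂ ℕ.* k)
    regroup′ = solve-∀
    collectₖ : ∀ p₁ r₁ r₂ h k u v → r₁ ℕ.* (u ℕ.+ r₂ ℕ.* h) ℕ.+ r₂ ℕ.* (v ℕ.+ p₁ ℕ.* k) ≡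
               r₁ ℕ.* u ℕ.+ r₂ ℕ.* v ℕ.+ (r₁ ℕ.* (r₂ ℕ.* h) ℕ.+ r₂ ℕ.* (p₁ ℕ.* k))
    collectₖ = solve-∀

  comb-injective : ∀ {u v u′ v′} → comb p₁ p₂ u v ≡ comb p₁ p₂ u′ v′ → comb r₁ r₂ u v ≡ comb r₁ r₂ u′ v′ →
                   u ≡ u′ × v ≡ v′
  comb-injective {u} {v} {u′} {v′} eqₕ eqₖ =
    ℕ.+-cancelʳ-≡ (r₂ ℕ.* comb p₁ p₂ u v) u u′
      (trans (sym (cross₂ u v)) (trans (cong (p₂ ℕ.*_) eqₖ) (trans (cross₂ u′ v′) (cong (λ h → u′ ℕ.+ r₂ ℕ.* h) (sym eqₕ))))) ,
    ℕ.+-cancelʳ-≡ (p₁ ℕ.* comb r₁ r₂ u v) v v′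
      (trans (sym (cross₁ u v)) (trans (cong (ℕ._* r₁) eqₕ) (trans (cross₁ u′ v′) (cong (λ k → v′ ℕ.+ p₁ ℕ.* k) (sym eqₖ)))))

  comb-coprime⁺ : ∀ {u v} → Coprime u v → Coprime (comb p₁ p₂ u v) (comb r₁ r₂ u v)
  comb-coprime⁺ {u} {v} cop {d} (d∣h , d∣k) = cop
    ( ∣m+n∣m⇒∣n (subst (d ∣_) (trans (cross₂ u v) (ℕ.+-comm u _)) (∣n⇒∣m*n p₂ d∣k)) (∣n⇒∣m*n r₂ d∣h)
    , ∣m+n∣m⇒∣n (subst (d ∣_) (trans (cross₁ u v) (ℕ.+-comm v _)) (∣m⇒∣m*n r₁ d∣h)) (∣n⇒∣m*n p₁ d∣k) )

  -- By the inverse matrix, (p₁q+p₂)k - h(r₁q+r₂) = (p₂k - r₂h) - q(hr₁ - p₁k) = u - qv. Comparing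
  -- h/k with the weighted mediant is therefore comparing u with qv, and t = 1 makes the comparison
  -- strict.
  below-mediant⁺ : ∀ q t {u v} → q ℕ.* v ℕ.+ t ℕ.≤ u →
                   t ℕ.+ comb p₁ p₂ u v ℕ.* (r₁ ℕ.* q ℕ.+ r₂) ℕ.≤ (p₁ ℕ.* q ℕ.+ p₂) ℕ.* comb r₁ r₂ u v
  below-mediant⁺ q t {u} {v} qv+t≤u = ℕ.+-cancelʳ-≤ (q ℕ.* v) _ _ (begin
    t ℕ.+ h ℕ.* (r₁ ℕ.* q ℕ.+ r₂) ℕ.+ q ℕ.* v               ≡⟨ expand q t h r₁ r₂ v ⟩
    q ℕ.* (h ℕ.* r₁) ℕ.+ r₂ ℕ.* h ℕ.+ (q ℕ.* v ℕ.+ t)       ≤⟨ ℕ.+-monoʳ-≤ (q ℕ.* (h ℕ.* r₁) ℕ.+ r₂ ℕ.* h) qv+t≤u ⟩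
    q ℕ.* (h ℕ.* r₁) ℕ.+ r₂ ℕ.* h ℕ.+ u                     ≡⟨ ℕ.+-assoc (q ℕ.* (h ℕ.* r₁)) _ u ⟩
    q ℕ.* (h ℕ.* r₁) ℕ.+ (r₂ ℕ.* h ℕ.+ u)                   ≡⟨ cong₂ (λ x y → q ℕ.* x ℕ.+ y) (cross₁ u v) (trans (ℕ.+-comm _ u) (sym (cross₂ u v))) ⟩
    q ℕ.* (v ℕ.+ p₁ ℕ.* k) ℕ.+ p₂ ℕ.* k                     ≡⟨ collect q v p₁ p₂ k ⟩
    (p₁ ℕ.* q ℕ.+ p₂) ℕ.* k ℕ.+ q ℕ.* v                     ∎)
    where
    open ℕ.≤-Reasoning
    h = comb p₁ p₂ u v
    k = comb r₁ r₂ u v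
    expand : ∀ q t h r₁ r₂ v → t ℕ.+ h ℕ.* (r₁ ℕ.* q ℕ.+ r₂) ℕ.+ q ℕ.* v ≡ q ℕ.* (h ℕ.* r₁) ℕ.+ r₂ ℕ.* h ℕ.+ (q ℕ.* v ℕ.+ t)
    expand = solve-∀
    collect : ∀ q v p₁ p₂ k → q ℕ.* (v ℕ.+ p₁ ℕ.* k) ℕ.+ p₂ ℕ.* k ≡ (p₁ ℕ.* q ℕ.+ p₂) ℕ.* k ℕ.+ q ℕ.* v
    collect = solve-∀

  below-mediant⁻ : ∀ q t {h k} → p₁ ℕ.* k ℕ.≤ h ℕ.* r₁ →
                   t ℕ.+ h ℕ.* (r₁ ℕ.* q ℕ.+ r₂) ℕ.≤ (p₁ ℕ.* q ℕ.+ p₂) ℕ.* k →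
                   ∃[ u ] ∃[ v ] (h ≡ comb p₁ p₂ u v × k ≡ comb r₁ r₂ u v)
                               × h ℕ.* r₁ ≡ v ℕ.+ p₁ ℕ.* k × q ℕ.* v ℕ.+ t ℕ.≤ u
  below-mediant⁻ q t {h} {k} p₁k≤hr₁ le =
    u , v , coordinates eq₁ eq₂ , eq₁ ,
    ℕ.+-cancelʳ-≤ (r₂ ℕ.* h) _ _ (ℕ.≤-trans bound (ℕ.≤-reflexive eq₂))
    where
    open ℕ.≤-Reasoning
    -- Neither subtraction is truncated: for `v` this is the hypothesis p₁k ≤ hr₁, for `u` it
    -- follows from `bound`, which is proved without mentioning `u`.
    v = h ℕ.* r₁ ℕ.∸ p₁ ℕ.* k
    u = p₂ ℕ.* k ℕ.∸ r₂ ℕ.* h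
    eq₁ : h ℕ.* r₁ ≡ v ℕ.+ p₁ ℕ.* k
    eq₁ = sym (ℕ.m∸n+n≡m p₁k≤hr₁)
    expand : ∀ q t h p₁ k r₂ v → q ℕ.* v ℕ.+ t ℕ.+ r₂ ℕ.* h ℕ.+ q ℕ.* (p₁ ℕ.* k) ≡ t ℕ.+ q ℕ.* (v ℕ.+ p₁ ℕ.* k) ℕ.+ r₂ ℕ.* h
    expand = solve-∀
    regroup : ∀ q t h r₁ r₂ → t ℕ.+ q ℕ.* (h ℕ.* r₁) ℕ.+ r₂ ℕ.* h ≡ t ℕ.+ h ℕ.* (r₁ ℕ.* q ℕ.+ r₂)
    regroup = solve-∀
    collect : ∀ q p₁ p₂ k → (p₁ ℕ.* q ℕ.+ p₂) ℕ.* k ≡ p₂ ℕ.* k ℕ.+ q ℕ.* (p₁ ℕ.* k)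
    collect = solve-∀
    bound : q ℕ.* v ℕ.+ t ℕ.+ r₂ ℕ.* h ℕ.≤ p₂ ℕ.* k
    bound = ℕ.+-cancelʳ-≤ (q ℕ.* (p₁ ℕ.* k)) _ _ (begin
      q ℕ.* v ℕ.+ t ℕ.+ r₂ ℕ.* h ℕ.+ q ℕ.* (p₁ ℕ.* k)  ≡⟨ expand q t h p₁ k r₂ v ⟩
      t ℕ.+ q ℕ.* (v ℕ.+ p₁ ℕ.* k) ℕ.+ r₂ ℕ.* h        ≡⟨ cong (λ x → t ℕ.+ q ℕ.* x ℕ.+ r₂ ℕ.* h) eq₁ ⟨
      t ℕ.+ q ℕ.* (h ℕ.* r₁) ℕ.+ r₂ ℕ.* h              ≡⟨ regroup q t h r₁ r₂ ⟩
      t ℕ.+ h ℕ.* (r₁ ℕ.* q ℕ.+ r₂)                    ≤⟨ le ⟩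
      (p₁ ℕ.* q ℕ.+ p₂) ℕ.* k                          ≡⟨ collect q p₁ p₂ k ⟩
      p₂ ℕ.* k ℕ.+ q ℕ.* (p₁ ℕ.* k)                    ∎)
    eq₂ : p₂ ℕ.* k ≡ u ℕ.+ r₂ ℕ.* h
    eq₂ = sym (ℕ.m∸n+n≡m (ℕ.≤-trans (ℕ.m≤n+m _ (q ℕ.* v ℕ.+ t)) bound))

-- Lattice points of the cone

-- With t = 0 the ray u = qv is included, with t = 1 it is excluded.
slice? : ∀ b₁ b₂ q L t v → Decidable (λ u → (Coprime u v × q ℕ.* v ℕ.+ t ℕ.≤ u) × comb b₁ b₂ u v ℕ.≤ b₁ ℕ.* L)
slice? b₁ b₂ q L t v u = (coprime? u v ×-dec q ℕ.* v ℕ.+ t ℕ.≤? u) ×-dec comb b₁ b₂ u v ℕ.≤? b₁ ℕ.* L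

slice : (b₁ b₂ q L t v : ℕ) → ℕ
slice b₁ b₂ q L t v = ∑ (suc L) (λ u → χ (slice? b₁ b₂ q L t v u))

excess : (b₁ b₂ q L t v : ℕ) → ℕ
excess b₁ b₂ q L t v = ∑ (suc L) (λ u →
  χ ((coprime? u v ×-dec q ℕ.* v ℕ.+ t ℕ.≤? u) ×-dec ¬? (comb b₁ b₂ u v ℕ.≤? b₁ ℕ.* L)))

-- Only the last w values of u up to L can violate b₁u + b₂v ≤ b₁L.
excess-≤ : ∀ b₁ b₂ q L t v w → b₂ ℕ.* v ℕ.≤ b₁ ℕ.* w → w ℕ.≤ suc L → excess b₁ b₂ q L t v ℕ.≤ w
excess-≤ b₁ b₂ q L t v w b₂v≤b₁w w≤1+L = begin
  ∑ (suc L) (χ ∘ violates?)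
    ≡⟨ cong (λ n → ∑ n (χ ∘ violates?)) (ℕ.m∸n+n≡m w≤1+L) ⟨
  ∑ (suc L ℕ.∸ w ℕ.+ w) (χ ∘ violates?)
    ≡⟨ ∑-split (suc L ℕ.∸ w) w (χ ∘ violates?) ⟩
  ∑ (suc L ℕ.∸ w) (χ ∘ violates?) ℕ.+ last-w
    ≡⟨ cong (ℕ._+ last-w) (∑-zero (suc L ℕ.∸ w) (λ {u} u<1+L∸w → χ-no (violates? u) (λ (_ , ¬fits) → ¬fits (fits u<1+L∸w)))) ⟩
  last-w
    ≤⟨ ∑-mono-≤ w (λ {j} _ → χ≤1 (violates? (suc L ℕ.∸ w ℕ.+ j))) ⟩
  ∑ w (λ _ → 1)
    ≡⟨ trans (∑-const w 1) (ℕ.*-identityʳ w) ⟩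
  w ∎
  where
  open ℕ.≤-Reasoning
  violates? : ∀ u → Dec ((Coprime u v × q ℕ.* v ℕ.+ t ℕ.≤ u) × ¬ (comb b₁ b₂ u v ℕ.≤ b₁ ℕ.* L))
  violates? u = (coprime? u v ×-dec q ℕ.* v ℕ.+ t ℕ.≤? u) ×-dec ¬? (comb b₁ b₂ u v ℕ.≤? b₁ ℕ.* L)
  last-w = ∑ w (λ j → χ (violates? (suc L ℕ.∸ w ℕ.+ j)))
  fits : ∀ {u} → u ℕ.< suc L ℕ.∸ w → comb b₁ b₂ u v ℕ.≤ b₁ ℕ.* L
  fits {u} u<1+L∸w = begin
    b₁ ℕ.* u ℕ.+ b₂ ℕ.* v  ≤⟨ ℕ.+-monoʳ-≤ (b₁ ℕ.* u) b₂v≤b₁w ⟩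
    b₁ ℕ.* u ℕ.+ b₁ ℕ.* w  ≡⟨ ℕ.*-distribˡ-+ b₁ u w ⟨
    b₁ ℕ.* (u ℕ.+ w)       ≤⟨ ℕ.*-monoʳ-≤ b₁ (ℕ.s≤s⁻¹ (ℕ.≤-trans (ℕ.+-monoˡ-≤ w u<1+L∸w) (ℕ.≤-reflexive (ℕ.m∸n+n≡m w≤1+L)))) ⟩
    b₁ ℕ.* L               ∎

-- The integers of [qv+t, L] coprime to v are divided between `slice` and `excess` according to
-- whether k ≤ N; `κ` supplies those below qv+t, which completes the range 0, ..., L.
slice+excess : ∀ b₁ b₂ q L t v → q ℕ.* v ℕ.+ t ℕ.≤ suc L →
               slice b₁ b₂ q L t v ℕ.+ excess b₁ b₂ q L t v ℕ.+ κ v (q ℕ.* v ℕ.+ t) ≡ κ v (suc L)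
slice+excess b₁ b₂ q L t v s≤1+L = begin
  slice b₁ b₂ q L t v ℕ.+ excess b₁ b₂ q L t v ℕ.+ κ v s
    ≡⟨ cong (ℕ._+ κ v s) (∑-+ (suc L) _ _) ⟨
  ∑ (suc L) (λ u → χ (above? u ×-dec fits? u) ℕ.+ χ (above? u ×-dec ¬? (fits? u))) ℕ.+ κ v s
    ≡⟨ cong (ℕ._+ κ v s) (∑-cong (suc L) (λ {u} _ → χ-split (above? u) (fits? u))) ⟨
  ∑ (suc L) (χ ∘ above?) ℕ.+ κ v s
    ≡⟨ cong (λ n → ∑ n (χ ∘ above?) ℕ.+ κ v s) (ℕ.m+[n∸m]≡n s≤1+L) ⟨
  ∑ (s ℕ.+ m) (χ ∘ above?) ℕ.+ κ v s
    ≡⟨ cong (ℕ._+ κ v s) (∑-split s m (χ ∘ above?)) ⟩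
  ∑ s (χ ∘ above?) ℕ.+ ∑ m (λ j → χ (above? (s ℕ.+ j))) ℕ.+ κ v s
    ≡⟨ cong (ℕ._+ κ v s) (cong₂ ℕ._+_
         (∑-zero s (λ {u} u<s → χ-no (above? u) (λ (_ , s≤u) → ℕ.<⇒≱ u<s s≤u)))
         (∑-cong m (λ {j} _ → χ-cong (above? (s ℕ.+ j)) (coprime? (s ℕ.+ j) v)
           (λ (cop , _) → λ {g} → cop {g}) (λ cop → (λ {g} → cop {g}) , ℕ.m≤m+n s j)))) ⟩
  ∑ m (λ j → χ (coprime? (s ℕ.+ j) v)) ℕ.+ κ v s
    ≡⟨ ℕ.+-comm _ (κ v s) ⟩
  κ v s ℕ.+ ∑ m (λ j → χ (coprime? (s ℕ.+ j) v))
    ≡⟨ ∑-split s m _ ⟨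
  κ v (s ℕ.+ m)
    ≡⟨ cong (κ v) (ℕ.m+[n∸m]≡n s≤1+L) ⟩
  κ v (suc L) ∎
  where
  open ≡-Reasoning
  s = q ℕ.* v ℕ.+ t
  m = suc L ℕ.∸ s
  fits? : ∀ u → Dec (comb b₁ b₂ u v ℕ.≤ b₁ ℕ.* L)
  fits? u = comb b₁ b₂ u v ℕ.≤? b₁ ℕ.* L
  above? : ∀ u → Dec (Coprime u v × s ℕ.≤ u)
  above? u = coprime? u v ×-dec s ℕ.≤? u

-- Serves both sides of a₁/b₁, with `P` the relevant half-open interval. The properties of the
-- substitution are hypotheses because the left side takes them from the matrix with its rows
-- exchanged. The condition 1 ≤ v + t removes v = 0, that is a₁/b₁ itself, when t = 0, and always
-- holds when t = 1.
cone-count : ∀ a₁ a₂ b₁ b₂ q L i t .{{_ : NonZero b₁}} .{{_ : NonZero q}} →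
             a₁ ℕ.≤ b₁ → a₁ ℕ.+ a₂ ℕ.≤ b₁ ℕ.+ b₂ → L ℕ.< q ℕ.* suc i →
             (∀ {u v u′ v′} → comb a₁ a₂ u v ≡ comb a₁ a₂ u′ v′ → comb b₁ b₂ u v ≡ comb b₁ b₂ u′ v′ → u ≡ u′ × v ≡ v′) →
             (∀ {u v} → Coprime u v → Coprime (comb a₁ a₂ u v) (comb b₁ b₂ u v)) →
             {P : ℕ × ℕ → Set} (P? : Decidable P) →
             (∀ {u v} → Reduced (comb b₁ b₂ u v , comb a₁ a₂ u v) → 1 ℕ.≤ v ℕ.+ t → q ℕ.* v ℕ.+ t ℕ.≤ u →
               P (comb b₁ b₂ u v , comb a₁ a₂ u v)) →
             (∀ {k h} → P (k , h) → Reduced (k , h) ×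
               (∃[ u ] ∃[ v ] (h ≡ comb a₁ a₂ u v × k ≡ comb b₁ b₂ u v) × 1 ℕ.≤ v ℕ.+ t × q ℕ.* v ℕ.+ t ℕ.≤ u)) →
             count P? (grid (suc (b₁ ℕ.* L)) (suc (b₁ ℕ.* L))) ≡
             ∑ (suc i) (λ v → ∑ (suc L) (λ u → χ (slice? b₁ b₂ q L t v u ×-dec 1 ℕ.≤? v ℕ.+ t)))
cone-count a₁ a₂ b₁ b₂ q L i t a₁≤b₁ a≤b L<q[1+i] T-injective T-coprime {P} P? P⁺ P⁻ =
  trans (sym (count-bijection R? P? (grid! (suc i) (suc L)) (grid! (suc N) (suc N)) T
               (λ eq → injective (cong proj₂ eq) (cong proj₁ eq)) forth back))
        (count-grid R? (suc i) (suc L))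
  where
  N = b₁ ℕ.* L
  grid! = λ m n → Unique.cartesianProduct⁺ (Unique.upTo⁺ m) (Unique.upTo⁺ n)
  R : ℕ × ℕ → Set
  R (v , u) = ((Coprime u v × q ℕ.* v ℕ.+ t ℕ.≤ u) × comb b₁ b₂ u v ℕ.≤ N) × 1 ℕ.≤ v ℕ.+ t
  R? : Decidable R
  R? (v , u) = slice? b₁ b₂ q L t v u ×-dec 1 ℕ.≤? v ℕ.+ t
  T : ℕ × ℕ → ℕ × ℕ
  T (v , u) = comb b₁ b₂ u v , comb a₁ a₂ u v

  injective : ∀ {x y : ℕ × ℕ} → proj₂ (T x) ≡ proj₂ (T y) → proj₁ (T x) ≡ proj₁ (T y) → x ≡ y
  injective eqₕ eqₖ = let u≡ , v≡ = T-injective eqₕ eqₖ in cong₂ _,_ v≡ u≡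

  v+t≤u : ∀ {u v} → q ℕ.* v ℕ.+ t ℕ.≤ u → v ℕ.+ t ℕ.≤ u
  v+t≤u {u} {v} = ℕ.≤-trans (ℕ.+-monoˡ-≤ t (ℕ.m≤n*m v q))

  -- With u = w + v the point is w times (a₁, b₁) plus v times the mediant (a₁+a₂, b₁+b₂), so it is
  -- enough that these two lie in [0,1].
  h≤k : ∀ {u v} → v ℕ.≤ u → comb a₁ a₂ u v ℕ.≤ comb b₁ b₂ u v
  h≤k {u} {v} v≤u = begin
    comb a₁ a₂ u v                        ≡⟨ decompose a₁ a₂ ⟩
    a₁ ℕ.* w ℕ.+ (a₁ ℕ.+ a₂) ℕ.* v        ≤⟨ ℕ.+-mono-≤ (ℕ.*-monoˡ-≤ w a₁≤b₁) (ℕ.*-monoˡ-≤ v a≤b) ⟩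
    b₁ ℕ.* w ℕ.+ (b₁ ℕ.+ b₂) ℕ.* v        ≡⟨ decompose b₁ b₂ ⟨
    comb b₁ b₂ u v                        ∎
    where
    open ℕ.≤-Reasoning
    w = u ℕ.∸ v
    expand : ∀ x y w v → x ℕ.* (w ℕ.+ v) ℕ.+ y ℕ.* v ≡ x ℕ.* w ℕ.+ (x ℕ.+ y) ℕ.* v
    expand = solve-∀
    decompose : ∀ x y → comb x y u v ≡ x ℕ.* w ℕ.+ (x ℕ.+ y) ℕ.* v
    decompose x y = trans (cong (λ z → x ℕ.* z ℕ.+ y ℕ.* v) (sym (ℕ.m∸n+n≡m v≤u))) (expand x y w v)

  forth : ∀ {x} → x ∈ grid (suc i) (suc L) → R x → T x ∈ grid (suc N) (suc N) × P (T x)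
  forth {v , u} _ (((cop , qv+t≤u) , k≤N) , 1≤v+t) =
    ∈-cartesianProduct⁺ (∈-upTo⁺ (s≤s k≤N)) (∈-upTo⁺ (s≤s (ℕ.≤-trans h≤k′ k≤N))) ,
    P⁺ ((0<k , h≤k′) , T-coprime (λ {g} → cop {g})) 1≤v+t qv+t≤u
    where
    v≤u = ℕ.≤-trans (ℕ.m≤m+n v t) (v+t≤u qv+t≤u)
    h≤k′ = h≤k v≤u
    0<k : 0 ℕ.< comb b₁ b₂ u v
    0<k = ℕ.≤-trans (ℕ.≤-trans 1≤v+t (ℕ.≤-trans (v+t≤u qv+t≤u) (ℕ.m≤n*m u b₁))) (ℕ.m≤m+n _ _)

  back : ∀ {y} → y ∈ grid (suc N) (suc N) → P y → ∃[ x ] x ∈ grid (suc i) (suc L) × y ≡ T x × R x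
  back {k , h} y∈ py with P⁻ py
  ... | ((_ , _) , cop) , u , v , (refl , refl) , 1≤v+t , qv+t≤u =
    (v , u) , ∈-cartesianProduct⁺ (∈-upTo⁺ v<1+i) (∈-upTo⁺ (s≤s u≤L)) , refl ,
    ((comb-coprime⁻ a₁ a₂ b₁ b₂ (λ {g} → cop {g}) , qv+t≤u) , k≤N) , 1≤v+t
    where
    k≤N : comb b₁ b₂ u v ℕ.≤ N
    k≤N = ℕ.s≤s⁻¹ (∈-upTo⁻ (proj₁ (∈-cartesianProduct⁻ (upTo (suc N)) (upTo (suc N)) y∈)))
    u≤L : u ℕ.≤ L
    u≤L = ℕ.*-cancelˡ-≤ b₁ (ℕ.≤-trans (ℕ.m≤m+n _ _) k≤N)
    v<1+i : v ℕ.< suc i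
    v<1+i = ℕ.*-cancelˡ-< q v (suc i)
      (ℕ.≤-<-trans (ℕ.≤-trans (ℕ.m≤m+n _ t) (ℕ.≤-trans qv+t≤u u≤L)) L<q[1+i])

≼-mono : ∀ a b c d .{{_ : NonZero b}} → a ℕ.* d ℕ.≤ c ℕ.* b → ∀ x → x ≼ a / b → x ≼ c / d
≼-mono a b c d ad≤cb (k , h) (reduced , hb≤ak) = reduced , ℕ.*-cancelˡ-≤ b (begin
  b ℕ.* (h ℕ.* d)  ≡⟨ swap b h d ⟩
  h ℕ.* b ℕ.* d    ≤⟨ ℕ.*-monoˡ-≤ d hb≤ak ⟩
  a ℕ.* k ℕ.* d    ≡⟨ swap′ a k d ⟩
  a ℕ.* d ℕ.* k    ≤⟨ ℕ.*-monoˡ-≤ k ad≤cb ⟩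
  c ℕ.* b ℕ.* k    ≡⟨ swap″ c b k ⟩
  b ℕ.* (c ℕ.* k)  ∎)
  where
  open ℕ.≤-Reasoning
  swap : ∀ b h d → b ℕ.* (h ℕ.* d) ≡ h ℕ.* b ℕ.* d
  swap = solve-∀
  swap′ : ∀ a k d → a ℕ.* k ℕ.* d ≡ a ℕ.* d ℕ.* k
  swap′ = solve-∀
  swap″ : ∀ c b k → c ℕ.* b ℕ.* k ≡ b ℕ.* (c ℕ.* k)
  swap″ = solve-∀

-- Half-open intervals to the right and to the left of a₁/b₁

module _ (a₁ a₂ b₁ b₂ q L i : ℕ) .{{b₁≢0 : NonZero b₁}} .{{q≢0 : NonZero q}}
         (a₁≤b₁ : a₁ ℕ.≤ b₁) (a≤b : a₁ ℕ.+ a₂ ℕ.≤ b₁ ℕ.+ b₂) (L<q[1+i] : L ℕ.< q ℕ.* suc i) where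

  private
    N = b₁ ℕ.* L
    c = a₁ ℕ.* q ℕ.+ a₂
    d = b₁ ℕ.* q ℕ.+ b₂
    instance
      d≢0 : NonZero d
      d≢0 = m*n+k≢0 b₁ q b₂

  I-right : a₂ ℕ.* b₁ ≡ suc (a₁ ℕ.* b₂) →
            I N (+ c / d) ≡ I N (+ a₁ / b₁) ℕ.+ ∑ i (λ j → slice b₁ b₂ q L 0 (suc j))
  I-right det = begin
    I N (+ c / d)
      ≡⟨ I-count N c d ⟩
    count (≼? c d) (grid (suc N) (suc N))
      ≡⟨ count-difference (≼? a₁ b₁) (≼? c d) (≼-mono a₁ b₁ c d a₁d≤cb₁) (grid (suc N) (suc N)) ⟩
    count (≼? a₁ b₁) (grid (suc N) (suc N)) ℕ.+ count P? (grid (suc N) (suc N))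
      ≡⟨ cong₂ ℕ._+_ (sym (I-count N a₁ b₁))
           (cone-count a₁ a₂ b₁ b₂ q L i 0 a₁≤b₁ a≤b L<q[1+i] U.comb-injective U.comb-coprime⁺ P? P⁺ P⁻) ⟩
    I N (+ a₁ / b₁) ℕ.+ ∑ (suc i) (λ v → ∑ (suc L) (λ u → χ (cone? v u)))
      ≡⟨ cong (I N (+ a₁ / b₁) ℕ.+_) (∑-head i _) ⟩
    I N (+ a₁ / b₁) ℕ.+ (∑ (suc L) (λ u → χ (cone? 0 u)) ℕ.+ ∑ i (λ j → ∑ (suc L) (λ u → χ (cone? (suc j) u))))
      ≡⟨ cong (I N (+ a₁ / b₁) ℕ.+_) (cong₂ ℕ._+_
           (∑-zero (suc L) (λ {u} _ → χ-no (cone? 0 u) (λ { (_ , ()) })))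
           (∑-cong i (λ {j} _ → ∑-cong (suc L) (λ {u} _ →
             χ-cong (cone? (suc j) u) (slice? b₁ b₂ q L 0 (suc j) u) proj₁ (λ r → r , s≤s z≤n))))) ⟩
    I N (+ a₁ / b₁) ℕ.+ ∑ i (λ j → slice b₁ b₂ q L 0 (suc j)) ∎
    where
    open ≡-Reasoning
    module U = Unimodular a₁ a₂ b₁ b₂ det
    cone? = λ v u → slice? b₁ b₂ q L 0 v u ×-dec 1 ℕ.≤? v ℕ.+ 0
    P : ℕ × ℕ → Set
    P x = x ≼ c / d × ¬ (x ≼ a₁ / b₁)
    P? : Decidable P
    P? x = ≼? c d x ×-dec ¬? (≼? a₁ b₁ x)

    a₁d≤cb₁ : a₁ ℕ.* d ℕ.≤ c ℕ.* b₁
    a₁d≤cb₁ = subst₂ ℕ._≤_ (sym (expand a₁ b₁ b₂ q)) (sym (ℕ.*-distribʳ-+ b₁ (a₁ ℕ.* q) a₂))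
      (ℕ.+-monoʳ-≤ (a₁ ℕ.* q ℕ.* b₁) (ℕ.≤-trans (ℕ.n≤1+n _) (ℕ.≤-reflexive (sym det))))
      where
      expand : ∀ a₁ b₁ b₂ q → a₁ ℕ.* (b₁ ℕ.* q ℕ.+ b₂) ≡ a₁ ℕ.* q ℕ.* b₁ ℕ.+ a₁ ℕ.* b₂
      expand = solve-∀

    P⁺ : ∀ {u v} → Reduced (comb b₁ b₂ u v , comb a₁ a₂ u v) → 1 ℕ.≤ v ℕ.+ 0 → q ℕ.* v ℕ.+ 0 ℕ.≤ u →
         P (comb b₁ b₂ u v , comb a₁ a₂ u v)
    P⁺ {u} {v} reduced 1≤v qv≤u = (reduced , U.below-mediant⁺ q 0 qv≤u) , λ (_ , hb₁≤a₁k) →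
      ℕ.<⇒≱ (ℕ.m<n+m _ (subst (1 ℕ.≤_) (ℕ.+-identityʳ v) 1≤v)) (ℕ.≤-trans (ℕ.≤-reflexive (sym (U.cross₁ u v))) hb₁≤a₁k)

    P⁻ : ∀ {k h} → P (k , h) → Reduced (k , h) ×
         (∃[ u ] ∃[ v ] (h ≡ comb a₁ a₂ u v × k ≡ comb b₁ b₂ u v) × 1 ℕ.≤ v ℕ.+ 0 × q ℕ.* v ℕ.+ 0 ℕ.≤ u)
    P⁻ {k} {h} ((reduced , hd≤ck) , ≰a₁/b₁) =
      -- Being strictly above a₁/b₁ makes v = hb₁ - a₁k positive, which is the condition 1 ≤ v + 0.
      let a₁k<hb₁ = ℕ.≰⇒> (λ hb₁≤a₁k → ≰a₁/b₁ (reduced , hb₁≤a₁k))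
          u , v , eqs , eq₁ , qv≤u = U.below-mediant⁻ q 0 (ℕ.<⇒≤ a₁k<hb₁) hd≤ck
      in reduced , u , v , eqs ,
         ℕ.≤-trans (ℕ.+-cancelʳ-< (a₁ ℕ.* k) 0 v (ℕ.<-≤-trans a₁k<hb₁ (ℕ.≤-reflexive eq₁))) (ℕ.m≤m+n v 0) , qv≤u

  -- Here the slice v = 0 stays: its point (1,0) is a₁/b₁, which belongs to the interval closed on
  -- the right.
  I-left : b₂ ℕ.* a₁ ≡ suc (b₁ ℕ.* a₂) →
           I N (+ a₁ / b₁) ≡
           I N (+ c / d) ℕ.+ (slice b₁ b₂ q L 1 0 ℕ.+ ∑ i (λ j → slice b₁ b₂ q L 1 (suc j)))
  I-left det = begin
    I N (+ a₁ / b₁)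
      ≡⟨ I-count N a₁ b₁ ⟩
    count (≼? a₁ b₁) (grid (suc N) (suc N))
      ≡⟨ count-difference (≼? c d) (≼? a₁ b₁) (≼-mono c d a₁ b₁ cb₁≤a₁d) (grid (suc N) (suc N)) ⟩
    count (≼? c d) (grid (suc N) (suc N)) ℕ.+ count P? (grid (suc N) (suc N))
      ≡⟨ cong₂ ℕ._+_ (sym (I-count N c d))
           (cone-count a₁ a₂ b₁ b₂ q L i 1 a₁≤b₁ a≤b L<q[1+i]
             (λ eqₕ eqₖ → U.comb-injective eqₖ eqₕ) (λ cop → Coprimality.sym (U.comb-coprime⁺ cop)) P? P⁺ P⁻) ⟩
    I N (+ c / d) ℕ.+ ∑ (suc i) (λ v → ∑ (suc L) (λ u → χ (cone? v u)))
      ≡⟨ cong (I N (+ c / d) ℕ.+_) (∑-cong (suc i) (λ {v} _ → ∑-cong (suc L) (λ {u} _ →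
           χ-cong (cone? v u) (slice? b₁ b₂ q L 1 v u) proj₁ (λ r → r , ℕ.m≤n+m 1 v)))) ⟩
    I N (+ c / d) ℕ.+ ∑ (suc i) (slice b₁ b₂ q L 1)
      ≡⟨ cong (I N (+ c / d) ℕ.+_) (∑-head i _) ⟩
    I N (+ c / d) ℕ.+ (slice b₁ b₂ q L 1 0 ℕ.+ ∑ i (λ j → slice b₁ b₂ q L 1 (suc j))) ∎
    where
    open ≡-Reasoning
    -- Taking reciprocals turns h/k > c/d into k/h < d/c, so the criterion for lying below the
    -- mediant applies with denominators in the place of numerators.
    module U = Unimodular b₁ b₂ a₁ a₂ det
    cone? = λ v u → slice? b₁ b₂ q L 1 v u ×-dec 1 ℕ.≤? v ℕ.+ 1
    P : ℕ × ℕ → Set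
    P x = x ≼ a₁ / b₁ × ¬ (x ≼ c / d)
    P? : Decidable P
    P? x = ≼? a₁ b₁ x ×-dec ¬? (≼? c d x)

    cb₁≤a₁d : c ℕ.* b₁ ℕ.≤ a₁ ℕ.* d
    cb₁≤a₁d = subst₂ ℕ._≤_ (sym (expandˡ a₁ a₂ b₁ q)) (sym (expandʳ a₁ b₁ b₂ q))
      (ℕ.+-monoʳ-≤ (a₁ ℕ.* b₁ ℕ.* q) (ℕ.≤-trans (ℕ.n≤1+n _) (ℕ.≤-reflexive (sym det))))
      where
      expandˡ : ∀ a₁ a₂ b₁ q → (a₁ ℕ.* q ℕ.+ a₂) ℕ.* b₁ ≡ a₁ ℕ.* b₁ ℕ.* q ℕ.+ b₁ ℕ.* a₂
      expandˡ = solve-∀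
      expandʳ : ∀ a₁ b₁ b₂ q → a₁ ℕ.* (b₁ ℕ.* q ℕ.+ b₂) ≡ a₁ ℕ.* b₁ ℕ.* q ℕ.+ b₂ ℕ.* a₁
      expandʳ = solve-∀

    P⁺ : ∀ {u v} → Reduced (comb b₁ b₂ u v , comb a₁ a₂ u v) → 1 ℕ.≤ v ℕ.+ 1 → q ℕ.* v ℕ.+ 1 ℕ.≤ u →
         P (comb b₁ b₂ u v , comb a₁ a₂ u v)
    P⁺ {u} {v} reduced _ qv<u =
      (reduced , subst₂ ℕ._≤_ (ℕ.*-comm b₁ h) (trans (sym (U.cross₁ u v)) (ℕ.*-comm k a₁)) (ℕ.m≤n+m _ v)) ,
      λ (_ , hd≤ck) → ℕ.<⇒≱ (subst₂ ℕ._<_ (ℕ.*-comm k c) (ℕ.*-comm d h) (U.below-mediant⁺ q 1 qv<u)) hd≤ck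
      where
      h = comb a₁ a₂ u v
      k = comb b₁ b₂ u v

    P⁻ : ∀ {k h} → P (k , h) → Reduced (k , h) ×
         (∃[ u ] ∃[ v ] (h ≡ comb a₁ a₂ u v × k ≡ comb b₁ b₂ u v) × 1 ℕ.≤ v ℕ.+ 1 × q ℕ.* v ℕ.+ 1 ℕ.≤ u)
    P⁻ {k} {h} ((reduced , hb₁≤a₁k) , ≰c/d) =
      let ck<hd = ℕ.≰⇒> (λ hd≤ck → ≰c/d (reduced , hd≤ck))
          u , v , (k≡ , h≡) , _ , qv<u =
            U.below-mediant⁻ q 1 (subst₂ ℕ._≤_ (ℕ.*-comm h b₁) (ℕ.*-comm a₁ k) hb₁≤a₁k)
                                 (subst₂ ℕ._<_ (ℕ.*-comm c k) (ℕ.*-comm h d) ck<hd)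
      in reduced , u , v , (h≡ , k≡) , ℕ.m≤n+m 1 v , qv<u

-- Summation over the slices v = 1, …, i

Φ-∑ : ∀ i → Φ i ≡ ∑ i (φ ∘ suc)
Φ-∑ zero    = refl
Φ-∑ (suc i) = cong (ℕ._+ φ (suc i)) (Φ-∑ i)

-- This is L times the sum of φ(j)/j, kept in ℕ: the quotients are exact wherever it is used,
-- because every j ≤ i divides L.
W : ℕ → ℕ → ℕ
W L i = ∑ i (λ j → L ℕ./ suc j ℕ.* φ (suc j))

κ-suc-∣ : ∀ v L .{{_ : NonZero v}} → v ∣ L → κ v (suc L) ≡ L ℕ./ v ℕ.* φ v ℕ.+ χ (coprime? 0 v)
κ-suc-∣ v _ (divides m refl) =
  trans (κ-suc-multiple v m) (cong (λ x → x ℕ.* φ v ℕ.+ χ (coprime? 0 v)) (sym (ℕ.m*n/n≡m m v)))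

module _ (b₁ b₂ q L i : ℕ) .{{q≢0 : NonZero q}}
         (qi≤L : q ℕ.* i ℕ.≤ L) (∣L : ∀ {j} → j ℕ.< i → suc j ∣ L) where

  private
    qv≤L : ∀ {j} → j ℕ.< i → q ℕ.* suc j ℕ.≤ L
    qv≤L j<i = ℕ.≤-trans (ℕ.*-monoʳ-≤ q j<i) qi≤L

  -- For w = 1 the hypothesis is b₂ ≤ b₁, and the slice of v loses at most its last v ≤ i points.
  -- For w = 0 it forces b₂ = 0 and nothing is lost, which makes the formula for 1/q exact.
  ∑excess-≤ : ∀ t w → b₂ ℕ.≤ b₁ ℕ.* w → w ℕ.≤ 1 → ∑ i (λ j → excess b₁ b₂ q L t (suc j)) ℕ.≤ w ℕ.* (i ℕ.^ 2)
  ∑excess-≤ t w b₂≤b₁w w≤1 = begin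
    ∑ i (λ j → excess b₁ b₂ q L t (suc j))
      ≤⟨ ∑-mono-≤ i (λ {j} j<i → excess-≤ b₁ b₂ q L t (suc j) (w ℕ.* suc j)
           (subst (b₂ ℕ.* suc j ℕ.≤_) (ℕ.*-assoc b₁ w (suc j)) (ℕ.*-monoˡ-≤ (suc j) b₂≤b₁w))
           (ℕ.≤-trans (ℕ.*-mono-≤ w≤1 j<i) (ℕ.≤-trans (ℕ.≤-reflexive (ℕ.*-identityˡ i))
             (ℕ.≤-trans (ℕ.m≤n*m i q) (ℕ.m≤n⇒m≤1+n qi≤L))))) ⟩
    ∑ i (λ j → w ℕ.* suc j)
      ≤⟨ ∑-mono-≤ i (λ j<i → ℕ.*-monoʳ-≤ w j<i) ⟩
    ∑ i (λ _ → w ℕ.* i)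
      ≡⟨ ∑-const i (w ℕ.* i) ⟩
    i ℕ.* (w ℕ.* i)
      ≡⟨ rearrange i w ⟩
    w ℕ.* (i ℕ.^ 2) ∎
    where
    open ℕ.≤-Reasoning
    rearrange : ∀ i w → i ℕ.* (w ℕ.* i) ≡ w ℕ.* (i ℕ.* (i ℕ.* 1))
    rearrange = solve-∀

  -- `δ` stands for what the end point u = qv contributes to a slice. It is a parameter because it
  -- depends on whether that end point is included.
  ∑slice : ∀ t (δ : ℕ → ℕ) →
           (∀ {j} → j ℕ.< i → slice b₁ b₂ q L t (suc j) ℕ.+ excess b₁ b₂ q L t (suc j) ℕ.+ q ℕ.* φ (suc j)
                              ≡ L ℕ./ suc j ℕ.* φ (suc j) ℕ.+ δ j) →
           ∑ i (λ j → slice b₁ b₂ q L t (suc j)) ℕ.+ ∑ i (λ j → excess b₁ b₂ q L t (suc j)) ℕ.+ q ℕ.* Φ i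
           ≡ W L i ℕ.+ ∑ i δ
  ∑slice t δ eq = begin
    ∑ i s ℕ.+ ∑ i e ℕ.+ q ℕ.* Φ i
      ≡⟨ cong₂ ℕ._+_ (sym (∑-+ i s e)) (trans (cong (q ℕ.*_) (Φ-∑ i)) (sym (∑-*ˡ i q (φ ∘ suc)))) ⟩
    ∑ i (λ j → s j ℕ.+ e j) ℕ.+ ∑ i (λ j → q ℕ.* φ (suc j))
      ≡⟨ ∑-+ i _ _ ⟨
    ∑ i (λ j → s j ℕ.+ e j ℕ.+ q ℕ.* φ (suc j))
      ≡⟨ ∑-cong i eq ⟩
    ∑ i (λ j → L ℕ./ suc j ℕ.* φ (suc j) ℕ.+ δ j)
      ≡⟨ ∑-+ i _ δ ⟩
    W L i ℕ.+ ∑ i δ ∎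
    where
    open ≡-Reasoning
    s = λ j → slice b₁ b₂ q L t (suc j)
    e = λ j → excess b₁ b₂ q L t (suc j)

  ∑slice-right : .{{_ : NonZero i}} →
    ∑ i (λ j → slice b₁ b₂ q L 0 (suc j)) ℕ.+ ∑ i (λ j → excess b₁ b₂ q L 0 (suc j)) ℕ.+ q ℕ.* Φ i ≡ W L i ℕ.+ 1
  ∑slice-right = trans (∑slice 0 (λ j → χ (coprime? 0 (suc j))) term) (cong (W L i ℕ.+_) (∑-coprime-0 i))
    where
    term : ∀ {j} → j ℕ.< i → _
    term {j} j<i = trans
      (cong (slice b₁ b₂ q L 0 (suc j) ℕ.+ excess b₁ b₂ q L 0 (suc j) ℕ.+_)
        (sym (trans (cong (κ (suc j)) (ℕ.+-identityʳ (q ℕ.* suc j))) (κ-multiple (suc j) q))))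
      (trans (slice+excess b₁ b₂ q L 0 (suc j) (ℕ.m≤n⇒m≤1+n (subst (ℕ._≤ L) (sym (ℕ.+-identityʳ _)) (qv≤L j<i))))
             (κ-suc-∣ (suc j) L (∣L j<i)))

  -- For t = 1 the interval starts at qv + 1. The indicator of a multiple of v then occurs both in
  -- the part below the interval and in the full range up to L, and cancels.
  ∑slice-left :
    ∑ i (λ j → slice b₁ b₂ q L 1 (suc j)) ℕ.+ ∑ i (λ j → excess b₁ b₂ q L 1 (suc j)) ℕ.+ q ℕ.* Φ i ≡ W L i
  ∑slice-left = trans (∑slice 1 (λ _ → 0) term) (trans (cong (W L i ℕ.+_) (∑-zero i (λ _ → refl))) (ℕ.+-identityʳ (W L i)))
    where
    open ≡-Reasoning
    term : ∀ {j} → j ℕ.< i → slice b₁ b₂ q L 1 (suc j) ℕ.+ excess b₁ b₂ q L 1 (suc j) ℕ.+ q ℕ.* φ (suc j)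
                             ≡ L ℕ./ suc j ℕ.* φ (suc j) ℕ.+ 0
    term {j} j<i = ℕ.+-cancelʳ-≡ δ _ _ (begin
      s+e ℕ.+ q ℕ.* φ v ℕ.+ δ          ≡⟨ ℕ.+-assoc s+e _ δ ⟩
      s+e ℕ.+ (q ℕ.* φ v ℕ.+ δ)        ≡⟨ cong (s+e ℕ.+_) (κ-suc-multiple v q) ⟨
      s+e ℕ.+ κ v (suc (q ℕ.* v))      ≡⟨ cong (λ n → s+e ℕ.+ κ v n) (ℕ.+-comm 1 (q ℕ.* v)) ⟩
      s+e ℕ.+ κ v (q ℕ.* v ℕ.+ 1)      ≡⟨ slice+excess b₁ b₂ q L 1 v (subst (ℕ._≤ suc L) (ℕ.+-comm 1 (q ℕ.* v)) (s≤s (qv≤L j<i))) ⟩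
      κ v (suc L)                      ≡⟨ κ-suc-∣ v L (∣L j<i) ⟩
      L ℕ./ v ℕ.* φ v ℕ.+ δ            ≡⟨ cong (ℕ._+ δ) (ℕ.+-identityʳ _) ⟨
      L ℕ./ v ℕ.* φ v ℕ.+ 0 ℕ.+ δ      ∎)
      where
      v = suc j
      δ = χ (coprime? 0 v)
      s+e = slice b₁ b₂ q L 1 v ℕ.+ excess b₁ b₂ q L 1 v

-- Only u = 1 is coprime to 0. By the symmetry of coprimality this is `∑-coprime-0` with the
-- arguments exchanged.
κ-0-≤1 : ∀ n → κ 0 n ℕ.≤ 1
κ-0-≤1 zero          = z≤n
κ-0-≤1 (suc zero)    = z≤n
κ-0-≤1 (suc (suc n)) = ℕ.≤-reflexive (begin
  κ 0 (suc (suc n))                              ≡⟨ ∑-head (suc n) _ ⟩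
  ∑ (suc n) (λ j → χ (coprime? (suc j) 0))       ≡⟨ ∑-cong (suc n) (λ {j} _ →
    χ-cong (coprime? (suc j) 0) (coprime? 0 (suc j)) (λ cop → Coprimality.sym cop) (λ cop → Coprimality.sym cop)) ⟩
  ∑ (suc n) (λ j → χ (coprime? 0 (suc j)))       ≡⟨ ∑-coprime-0 (suc n) ⟩
  1                                              ∎)
  where open ≡-Reasoning

slice-0-≤1 : ∀ b₁ b₂ q L t → q ℕ.* 0 ℕ.+ t ℕ.≤ suc L → slice b₁ b₂ q L t 0 ℕ.≤ 1
slice-0-≤1 b₁ b₂ q L t le = ℕ.≤-trans (ℕ.≤-trans (ℕ.m≤m+n _ _) (ℕ.m≤m+n _ _))
  (ℕ.≤-trans (ℕ.≤-reflexive (slice+excess b₁ b₂ q L t 0 le)) (κ-0-≤1 (suc L)))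

-- 0 is coprime to a denominator only if that denominator is 1. This is one half of the constant 2
-- in the formula for 1/q; the other half is the end point (q,1).
I-0 : ∀ N .{{_ : NonZero N}} → I N (+ 0 / 1) ≡ 1
I-0 N = trans (I-∑ N 0 1) (trans (∑-cong N slice₀) (∑-coprime-0 N))
  where
  slice₀ : ∀ {k} → k ℕ.< N → ∑ (suc (suc k)) (λ h → χ (coprime? h (suc k) ×-dec h ℕ.* 1 ℕ.≤? 0)) ≡ χ (coprime? 0 (suc k))
  slice₀ {k} _ = trans (∑-head (suc k) _) (trans (cong₂ ℕ._+_
    (χ-cong (coprime? 0 (suc k) ×-dec 0 ℕ.≤? 0) (coprime? 0 (suc k)) (λ (cop , _) → λ {g} → cop {g}) (λ cop → (λ {g} → cop {g}) , z≤n))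
    (∑-zero (suc k) (λ {h} _ → χ-no (coprime? (suc h) (suc k) ×-dec suc h ℕ.* 1 ℕ.≤? 0) (λ { (_ , ()) }))))
    (ℕ.+-identityʳ _))

-- Passage to ℚ

fromℚᵘ-homo-+ : ∀ p q → fromℚᵘ (p ℚᵘ.+ q) ≡ fromℚᵘ p + fromℚᵘ q
fromℚᵘ-homo-+ p q = ℚ.toℚᵘ-injective (begin
  toℚᵘ (fromℚᵘ (p ℚᵘ.+ q))                  ≈⟨ ℚ.toℚᵘ-fromℚᵘ (p ℚᵘ.+ q) ⟩
  p ℚᵘ.+ q                                  ≈⟨ ℚᵘ.+-cong (ℚ.toℚᵘ-fromℚᵘ p) (ℚ.toℚᵘ-fromℚᵘ q) ⟨
  toℚᵘ (fromℚᵘ p) ℚᵘ.+ toℚᵘ (fromℚᵘ q)      ≈⟨ ℚ.toℚᵘ-homo-+ (fromℚᵘ p) (fromℚᵘ q) ⟨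
  toℚᵘ (fromℚᵘ p + fromℚᵘ q)                ∎)
  where open ℚᵘ.≃-Reasoning

fromℚᵘ-homo-* : ∀ p q → fromℚᵘ (p ℚᵘ.* q) ≡ fromℚᵘ p * fromℚᵘ q
fromℚᵘ-homo-* p q = ℚ.toℚᵘ-injective (begin
  toℚᵘ (fromℚᵘ (p ℚᵘ.* q))                  ≈⟨ ℚ.toℚᵘ-fromℚᵘ (p ℚᵘ.* q) ⟩
  p ℚᵘ.* q                                  ≈⟨ ℚᵘ.*-cong (ℚ.toℚᵘ-fromℚᵘ p) (ℚ.toℚᵘ-fromℚᵘ q) ⟨
  toℚᵘ (fromℚᵘ p) ℚᵘ.* toℚᵘ (fromℚᵘ q)      ≈⟨ ℚ.toℚᵘ-homo-* (fromℚᵘ p) (fromℚᵘ q) ⟨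
  toℚᵘ (fromℚᵘ p * fromℚᵘ q)                ∎)
  where open ℚᵘ.≃-Reasoning

ℕ→ℚ-+ : ∀ m n → ℕ→ℚ (m ℕ.+ n) ≡ ℕ→ℚ m + ℕ→ℚ n
ℕ→ℚ-+ m n = trans
  (ℚ.fromℚᵘ-cong {mkℚᵘ (+ (m ℕ.+ n)) 0} {mkℚᵘ (+ m) 0 ℚᵘ.+ mkℚᵘ (+ n) 0}
    (*≡* (cong (ℤ._* + 1) (sym (cong₂ ℤ._+_ (ℤ.*-identityʳ (+ m)) (ℤ.*-identityʳ (+ n)))))))
  (fromℚᵘ-homo-+ (mkℚᵘ (+ m) 0) (mkℚᵘ (+ n) 0))

ℕ→ℚ-* : ∀ m n → ℕ→ℚ (m ℕ.* n) ≡ ℕ→ℚ m * ℕ→ℚ n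
ℕ→ℚ-* m n = trans
  (ℚ.fromℚᵘ-cong {mkℚᵘ (+ (m ℕ.* n)) 0} {mkℚᵘ (+ m) 0 ℚᵘ.* mkℚᵘ (+ n) 0} (*≡* (cong (ℤ._* + 1) (ℤ.pos-* m n))))
  (fromℚᵘ-homo-* (mkℚᵘ (+ m) 0) (mkℚᵘ (+ n) 0))

ℕ→ℚ-mono-≤ : ∀ {m n} → m ℕ.≤ n → ℕ→ℚ m ≤ ℕ→ℚ n
ℕ→ℚ-mono-≤ {m} {n} m≤n = /-mono-≤ m 1 n 1 (ℕ.*-monoˡ-≤ 1 m≤n)

/-cancelˡ : ∀ d n .{{_ : NonZero d}} → + (d ℕ.* n) / d ≡ ℕ→ℚ n
/-cancelˡ d@(suc d-1) n = ℚ.fromℚᵘ-cong {mkℚᵘ (+ (d ℕ.* n)) d-1} {mkℚᵘ (+ n) 0} (*≡* (begin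
  + (d ℕ.* n) ℤ.* + 1  ≡⟨ ℤ.*-identityʳ _ ⟩
  + (d ℕ.* n)          ≡⟨ cong +_ (ℕ.*-comm d n) ⟩
  + (n ℕ.* d)          ≡⟨ ℤ.pos-* n d ⟩
  + n ℤ.* + d          ∎))
  where open ≡-Reasoning

ℕ→ℚ-*-/ : ∀ n a d .{{_ : NonZero d}} → d ∣ n → ℕ→ℚ n * (+ a / d) ≡ ℕ→ℚ (n ℕ./ d ℕ.* a)
ℕ→ℚ-*-/ _ a d@(suc d-1) (divides m refl) = begin
  ℕ→ℚ (m ℕ.* d) * (+ a / d)
    ≡⟨ fromℚᵘ-homo-* (mkℚᵘ (+ (m ℕ.* d)) 0) (mkℚᵘ (+ a) d-1) ⟨
  fromℚᵘ (mkℚᵘ (+ (m ℕ.* d)) 0 ℚᵘ.* mkℚᵘ (+ a) d-1)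
    ≡⟨ ℚ.fromℚᵘ-cong {mkℚᵘ (+ (m ℕ.* d)) 0 ℚᵘ.* mkℚᵘ (+ a) d-1} {mkℚᵘ (+ (d ℕ.* (m ℕ.* a))) d-1}
         (*≡* (cong₂ ℤ._*_ (trans (sym (ℤ.pos-* (m ℕ.* d) a)) (cong +_ (rearrange m d a)))
                           (cong (λ x → + suc x) (sym (ℕ.+-identityʳ d-1))))) ⟩
  + (d ℕ.* (m ℕ.* a)) / d
    ≡⟨ /-cancelˡ d (m ℕ.* a) ⟩
  ℕ→ℚ (m ℕ.* a)
    ≡⟨ cong (λ x → ℕ→ℚ (x ℕ.* a)) (ℕ.m*n/n≡m m d) ⟨
  ℕ→ℚ (m ℕ.* d ℕ./ d ℕ.* a) ∎
  where
  open ≡-Reasoning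
  rearrange : ∀ m d a → m ℕ.* d ℕ.* a ≡ d ℕ.* (m ℕ.* a)
  rearrange = solve-∀

L*∑φ/j : ∀ L i → (∀ {j} → j ℕ.< i → suc j ∣ L) → ℕ→ℚ L * ∑φ/j i ≡ ℕ→ℚ (W L i)
L*∑φ/j L zero    _  = ℚ.*-zeroʳ (ℕ→ℚ L)
L*∑φ/j L (suc i) ∣L = begin
  ℕ→ℚ L * (∑φ/j i + + φ (suc i) / suc i)
    ≡⟨ ℚ.*-distribˡ-+ (ℕ→ℚ L) (∑φ/j i) _ ⟩
  ℕ→ℚ L * ∑φ/j i + ℕ→ℚ L * (+ φ (suc i) / suc i)
    ≡⟨ cong₂ _+_ (L*∑φ/j L i (∣L ∘ ℕ.m<n⇒m<1+n)) (ℕ→ℚ-*-/ L (φ (suc i)) (suc i) (∣L (ℕ.n<1+n i))) ⟩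
  ℕ→ℚ (W L i) + ℕ→ℚ (L ℕ./ suc i ℕ.* φ (suc i))
    ≡⟨ ℕ→ℚ-+ (W L i) _ ⟨
  ℕ→ℚ (W L (suc i)) ∎
  where open ≡-Reasoning

-- Consequences of the hypotheses on N and on the Farey pair

suc∣lcmUpTo : ∀ {j} n → j ℕ.< n → suc j ∣ lcmUpTo n
suc∣lcmUpTo (suc n) j<1+n with ℕ.m<1+n⇒m<n∨m≡n j<1+n
... | inj₁ j<n  = ∣-trans (suc∣lcmUpTo n j<n) (m∣lcm[m,n] (lcmUpTo n) (suc n))
... | inj₂ refl = n∣lcm[m,n] (lcmUpTo n) (suc n)

-- Membership only provides some equal fraction h/(k+1) from the list, with h ≤ k+1; the inequality
-- is carried over to a and b by cross products.
Farey⇒≤ : ∀ {a b} M .{{_ : NonZero b}} → (+ a / b) ∈ Farey M → a ℕ.≤ b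
Farey⇒≤ {a} {b} M ∈F =
  let k , ∈k = satisfied (∈-concatMap⁻ _ {xs = upTo M} (∈-resp-↭ (sort-↭ _) ∈F))
      h , h∈ , a/b≡h/k , _ = ∈-map∘filter⁻ (λ h → + h / suc k) (λ h → coprime? h (suc k)) ∈k
  in ℕ.*-cancelʳ-≤ a b (suc k) (begin
    a ℕ.* suc k  ≤⟨ /-cancel-≤ a b h (suc k) (ℚ.≤-reflexive a/b≡h/k) ⟩
    h ℕ.* b      ≤⟨ ℕ.*-monoˡ-≤ b (ℕ.s≤s⁻¹ (∈-upTo⁻ h∈)) ⟩
    suc k ℕ.* b  ≡⟨ ℕ.*-comm (suc k) b ⟩
    b ℕ.* suc k  ∎)
  where open ℕ.≤-Reasoning

∣m-n∣≡1 : ∀ m n → ℕ.∣ m - n ∣ ≡ 1 → n ≡ suc m ⊎ m ≡ suc n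
∣m-n∣≡1 zero    n       eq = inj₁ eq
∣m-n∣≡1 (suc m) zero    eq = inj₂ eq
∣m-n∣≡1 (suc m) (suc n) eq with ∣m-n∣≡1 m n eq
... | inj₁ refl = inj₁ refl
... | inj₂ refl = inj₂ refl

-- The assumption 1 < b₁ rules out the pair 0/1, 1/0, for which a₂ ≤ b₂ fails.
regular-pair : ∀ {a₁ b₁ a₂ b₂} → FareyPair a₁ b₁ a₂ b₂ → 1 ℕ.< b₁ →
               a₁ ℕ.≤ b₁ × a₂ ℕ.≤ b₂ × ℕ.∣ a₁ ℕ.* b₂ - a₂ ℕ.* b₁ ∣ ≡ 1
regular-pair (regular M _ _ ∈F₁ ∈F₂ det) _ = Farey⇒≤ M ∈F₁ , Farey⇒≤ M ∈F₂ , det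
regular-pair exceptional (s≤s ())

sign-right : ∀ a₁ b₁ a₂ b₂ → a₂ ℕ.* b₁ ≡ suc (a₁ ℕ.* b₂) → sign a₁ b₁ a₂ b₂ ≡ 1ℚ
sign-right a₁ b₁ a₂ b₂ det =
  cong (if_then 1ℚ else - 1ℚ) (dec-true (a₁ ℕ.* b₂ ℕ.<? a₂ ℕ.* b₁) (ℕ.≤-reflexive (sym det)))

sign-left : ∀ a₁ b₁ a₂ b₂ → a₁ ℕ.* b₂ ≡ suc (a₂ ℕ.* b₁) → sign a₁ b₁ a₂ b₂ ≡ - 1ℚ
sign-left a₁ b₁ a₂ b₂ det =
  cong (if_then 1ℚ else - 1ℚ) (dec-false (a₁ ℕ.* b₂ ℕ.<? a₂ ℕ.* b₁) (ℕ.<⇒≯ (ℕ.≤-reflexive (sym det))))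

-- Two numbers in [0, o] differ by at most o. The boundary point and the excess are thus bounded by
-- the larger of their bounds and not by the sum, which keeps the constant at 1.
∣ℕ→ℚ-ℕ→ℚ∣≤ : ∀ {m n o} → m ℕ.≤ o → n ℕ.≤ o → ∣ ℕ→ℚ m - ℕ→ℚ n ∣ ≤ ℕ→ℚ o
∣ℕ→ℚ-ℕ→ℚ∣≤ {m} {n} {o} m≤o n≤o =
  [ (λ eq → subst (_≤ ℕ→ℚ o) (sym eq) (difference-≤ m n m≤o))
  , (λ eq → subst (_≤ ℕ→ℚ o) (sym (trans eq (flip (ℕ→ℚ m) (ℕ→ℚ n)))) (difference-≤ n m n≤o))
  ]′ (ℚ.∣p∣≡p∨∣p∣≡-p (ℕ→ℚ m - ℕ→ℚ n))
  where
  open +-*-Solver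
  flip : ∀ x y → - (x - y) ≡ y - x
  flip = solve 2 (λ x y → :- (x :- y) := y :- x) refl
  difference-≤ : ∀ m n → m ℕ.≤ o → ℕ→ℚ m - ℕ→ℚ n ≤ ℕ→ℚ o
  difference-≤ m n m≤o = subst (ℕ→ℚ m - ℕ→ℚ n ≤_) (ℚ.+-identityʳ (ℕ→ℚ o))
    (ℚ.+-mono-≤ (ℕ→ℚ-mono-≤ m≤o) (ℚ.neg-antimono-≤ (ℕ→ℚ-mono-≤ (z≤n {n}))))

ℕ→ℚ-+-+ : ∀ l m n → ℕ→ℚ (l ℕ.+ m ℕ.+ n) ≡ ℕ→ℚ l + ℕ→ℚ m + ℕ→ℚ n
ℕ→ℚ-+-+ l m n = trans (ℕ→ℚ-+ (l ℕ.+ m) n) (cong (_+ ℕ→ℚ n) (ℕ→ℚ-+ l m))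

-- Turns a subtraction-free count into the signed form of the theorem: m is the excess, n the term
-- qΦ(i), m′ the sum `W` and n′ the boundary point, so that the right-hand side is the exact error.
balance : ∀ l m n l′ m′ n′ → l ℕ.+ m ℕ.+ n ≡ l′ ℕ.+ m′ ℕ.+ n′ →
          ℕ→ℚ l - (ℕ→ℚ l′ + (ℕ→ℚ m′ - ℕ→ℚ n)) ≡ ℕ→ℚ n′ - ℕ→ℚ m
balance l m n l′ m′ n′ eq = begin
  x - (y + (w - f))            ≡⟨ expand x y w f e ⟩
  (x + e + f) - (y + w + e)    ≡⟨ cong (_- (y + w + e)) (trans (sym (ℕ→ℚ-+-+ l m n)) (trans (cong ℕ→ℚ eq) (ℕ→ℚ-+-+ l′ m′ n′))) ⟩
  (y + w + δ) - (y + w + e)    ≡⟨ collect y w δ e ⟩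
  δ - e                        ∎
  where
  open ≡-Reasoning
  x = ℕ→ℚ l
  e = ℕ→ℚ m
  f = ℕ→ℚ n
  y = ℕ→ℚ l′
  w = ℕ→ℚ m′
  δ = ℕ→ℚ n′
  open +-*-Solver
  expand : ∀ x y w f e → x - (y + (w - f)) ≡ (x + e + f) - (y + w + e)
  expand = solve 5 (λ x y w f e → x :- (y :+ (w :- f)) := (x :+ e :+ f) :- (y :+ w :+ e)) refl
  collect : ∀ y w δ e → (y + w + δ) - (y + w + e) ≡ δ - e
  collect = solve 4 (λ y w δ e → (y :+ w :+ δ) :- (y :+ w :+ e) := δ :- e) refl

private
  -- On the left the count expresses the position of a₁/b₁ through that of x. Solving for the latter
  -- negates the error.
  mirror : ∀ x a w f → x - (a + - 1ℚ * (w - f)) ≡ - (a - (x + (w - f)))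
  mirror = solve 4 (λ x a w f → x :- (a :+ :- con 1ℚ :* (w :- f)) := :- (a :- (x :+ (w :- f)))) refl
    where open +-*-Solver

module _ (b₁ i L q : ℕ) .{{_ : NonZero b₁}} .{{_ : NonZero i}} where

  private
    instance
      b₁[i+1]≢0 = m*n≢0 b₁ (suc i)
      b₁i≢0     = m*n≢0 b₁ i
    rearrange : ∀ q b i → q ℕ.* (b ℕ.* i) ≡ b ℕ.* (q ℕ.* i)
    rearrange = solve-∀

  -- As N = b₁L, the factor b₁ cancels. This bound keeps the slices to v ≤ i, while `q-upper-bound`
  -- gives qv ≤ L for each of these v.
  q-lower-bound : + (b₁ ℕ.* L) / (b₁ ℕ.* suc i) < ℕ→ℚ q → L ℕ.< q ℕ.* suc i
  q-lower-bound lt = ℕ.*-cancelˡ-< b₁ L (q ℕ.* suc i)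
    (subst₂ ℕ._<_ (ℕ.*-identityʳ _) (rearrange q b₁ (suc i)) (/-cancel-< (b₁ ℕ.* L) (b₁ ℕ.* suc i) q 1 lt))

  q-upper-bound : ℕ→ℚ q ≤ + (b₁ ℕ.* L) / (b₁ ℕ.* i) → q ℕ.* i ℕ.≤ L
  q-upper-bound le = ℕ.*-cancelˡ-≤ b₁
    (subst₂ ℕ._≤_ (rearrange q b₁ i) (ℕ.*-identityʳ _) (/-cancel-≤ q 1 (b₁ ℕ.* L) (b₁ ℕ.* i) le))

-- Balance identities and the error term

module _ (a₁ a₂ b₁ b₂ q L i : ℕ) .{{_ : NonZero b₁}} .{{_ : NonZero q}} .{{_ : NonZero i}}
         (a₁≤b₁ : a₁ ℕ.≤ b₁) (a≤b : a₁ ℕ.+ a₂ ℕ.≤ b₁ ℕ.+ b₂)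
         (L<q[1+i] : L ℕ.< q ℕ.* suc i) (qi≤L : q ℕ.* i ℕ.≤ L) (∣L : ∀ {j} → j ℕ.< i → suc j ∣ L) where

  private
    N = b₁ ℕ.* L
    instance d≢0 = m*n+k≢0 b₁ q b₂
    x = + (a₁ ℕ.* q ℕ.+ a₂) / (b₁ ℕ.* q ℕ.+ b₂)
    E = λ t → ∑ i (λ j → excess b₁ b₂ q L t (suc j))

  I-right-balance : a₂ ℕ.* b₁ ≡ suc (a₁ ℕ.* b₂) →
    I N x ℕ.+ E 0 ℕ.+ q ℕ.* Φ i ≡ I N (+ a₁ / b₁) ℕ.+ W L i ℕ.+ 1
  I-right-balance det = begin
    I N x ℕ.+ E 0 ℕ.+ q ℕ.* Φ i
      ≡⟨ cong (λ y → y ℕ.+ E 0 ℕ.+ q ℕ.* Φ i) (I-right a₁ a₂ b₁ b₂ q L i a₁≤b₁ a≤b L<q[1+i] det) ⟩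
    Y ℕ.+ S ℕ.+ E 0 ℕ.+ q ℕ.* Φ i
      ≡⟨ rearrange Y S (E 0) (q ℕ.* Φ i) ⟩
    Y ℕ.+ (S ℕ.+ E 0 ℕ.+ q ℕ.* Φ i)
      ≡⟨ cong (Y ℕ.+_) (∑slice-right b₁ b₂ q L i qi≤L ∣L) ⟩
    Y ℕ.+ (W L i ℕ.+ 1)
      ≡⟨ ℕ.+-assoc Y (W L i) 1 ⟨
    Y ℕ.+ W L i ℕ.+ 1 ∎
    where
    open ≡-Reasoning
    Y = I N (+ a₁ / b₁)
    S = ∑ i (λ j → slice b₁ b₂ q L 0 (suc j))
    rearrange : ∀ a s e f → a ℕ.+ s ℕ.+ e ℕ.+ f ≡ a ℕ.+ (s ℕ.+ e ℕ.+ f)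
    rearrange = solve-∀

  I-left-balance : a₁ ℕ.* b₂ ≡ suc (a₂ ℕ.* b₁) →
    I N (+ a₁ / b₁) ℕ.+ E 1 ℕ.+ q ℕ.* Φ i ≡ I N x ℕ.+ W L i ℕ.+ slice b₁ b₂ q L 1 0
  I-left-balance det = begin
    I N (+ a₁ / b₁) ℕ.+ E 1 ℕ.+ q ℕ.* Φ i
      ≡⟨ cong (λ y → y ℕ.+ E 1 ℕ.+ q ℕ.* Φ i) (I-left a₁ a₂ b₁ b₂ q L i a₁≤b₁ a≤b L<q[1+i]
           (trans (ℕ.*-comm b₂ a₁) (trans det (cong suc (ℕ.*-comm a₂ b₁))))) ⟩
    X ℕ.+ (s₀ ℕ.+ S) ℕ.+ E 1 ℕ.+ q ℕ.* Φ i
      ≡⟨ rearrange X s₀ S (E 1) (q ℕ.* Φ i) ⟩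
    X ℕ.+ (S ℕ.+ E 1 ℕ.+ q ℕ.* Φ i) ℕ.+ s₀
      ≡⟨ cong (λ y → X ℕ.+ y ℕ.+ s₀) (∑slice-left b₁ b₂ q L i qi≤L ∣L) ⟩
    X ℕ.+ W L i ℕ.+ s₀ ∎
    where
    open ≡-Reasoning
    X = I N x
    s₀ = slice b₁ b₂ q L 1 0
    S = ∑ i (λ j → slice b₁ b₂ q L 1 (suc j))
    rearrange : ∀ x s₀ s e f → x ℕ.+ (s₀ ℕ.+ s) ℕ.+ e ℕ.+ f ≡ x ℕ.+ (s ℕ.+ e ℕ.+ f) ℕ.+ s₀
    rearrange = solve-∀

  main-term : (+ N / b₁) * ∑φ/j i - ℕ→ℚ q * ℕ→ℚ (Φ i) ≡ ℕ→ℚ (W L i) - ℕ→ℚ (q ℕ.* Φ i)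
  main-term = cong₂ _-_ (trans (cong (_* ∑φ/j i) (/-cancelˡ b₁ L)) (L*∑φ/j L i ∣L)) (sym (ℕ→ℚ-* q (Φ i)))

  private
    1≤i² : 1 ℕ.≤ 1 ℕ.* (i ℕ.^ 2)
    1≤i² = subst (1 ℕ.≤_) (sym (ℕ.*-identityˡ (i ℕ.^ 2))) (ℕ.m^n>0 i 2)

    E-≤ : b₂ ℕ.≤ b₁ → ∀ t → E t ℕ.≤ 1 ℕ.* (i ℕ.^ 2)
    E-≤ b₂≤b₁ t = ∑excess-≤ b₁ b₂ q L i qi≤L ∣L t 1 (subst (b₂ ℕ.≤_) (sym (ℕ.*-identityʳ b₁)) b₂≤b₁) ℕ.≤-refl

    error : ℚ
    error = ℕ→ℚ (I N x)
      - (ℕ→ℚ (I N (+ a₁ / b₁)) + sign a₁ b₁ a₂ b₂ * ((+ N / b₁) * ∑φ/j i - ℕ→ℚ q * ℕ→ℚ (Φ i)))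

  error-right : a₂ ℕ.* b₁ ≡ suc (a₁ ℕ.* b₂) → error ≡ ℕ→ℚ 1 - ℕ→ℚ (E 0)
  error-right right = begin
    error
      ≡⟨ cong (λ y → ℕ→ℚ (I N x) - (ℕ→ℚ (I N (+ a₁ / b₁)) + y))
           (trans (cong₂ _*_ (sign-right a₁ b₁ a₂ b₂ right) main-term) (ℚ.*-identityˡ _)) ⟩
    ℕ→ℚ (I N x) - (ℕ→ℚ (I N (+ a₁ / b₁)) + (ℕ→ℚ (W L i) - ℕ→ℚ (q ℕ.* Φ i)))
      ≡⟨ balance (I N x) (E 0) (q ℕ.* Φ i) (I N (+ a₁ / b₁)) (W L i) 1 (I-right-balance right) ⟩
    ℕ→ℚ 1 - ℕ→ℚ (E 0) ∎
    where open ≡-Reasoning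

  error-left : a₁ ℕ.* b₂ ≡ suc (a₂ ℕ.* b₁) → error ≡ - (ℕ→ℚ (slice b₁ b₂ q L 1 0) - ℕ→ℚ (E 1))
  error-left left = begin
    error
      ≡⟨ cong (λ y → ℕ→ℚ (I N x) - (ℕ→ℚ (I N (+ a₁ / b₁)) + y)) (cong₂ _*_ (sign-left a₁ b₁ a₂ b₂ left) main-term) ⟩
    ℕ→ℚ (I N x) - (ℕ→ℚ (I N (+ a₁ / b₁)) + - 1ℚ * (ℕ→ℚ (W L i) - ℕ→ℚ (q ℕ.* Φ i)))
      ≡⟨ mirror (ℕ→ℚ (I N x)) (ℕ→ℚ (I N (+ a₁ / b₁))) (ℕ→ℚ (W L i)) (ℕ→ℚ (q ℕ.* Φ i)) ⟩
    - (ℕ→ℚ (I N (+ a₁ / b₁)) - (ℕ→ℚ (I N x) + (ℕ→ℚ (W L i) - ℕ→ℚ (q ℕ.* Φ i))))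
      ≡⟨ cong -_ (balance (I N (+ a₁ / b₁)) (E 1) (q ℕ.* Φ i) (I N x) (W L i) (slice b₁ b₂ q L 1 0) (I-left-balance left)) ⟩
    - (ℕ→ℚ (slice b₁ b₂ q L 1 0) - ℕ→ℚ (E 1)) ∎
    where open ≡-Reasoning

  -- The determinant is +1 or -1, which decides the side. The boundary point is exactly 1 on the
  -- right and at most 1 on the left, hence below i² because i is positive. The factor 1 is the
  -- constant C.
  ∣error∣≤i² : b₂ ℕ.≤ b₁ → ℕ.∣ a₁ ℕ.* b₂ - a₂ ℕ.* b₁ ∣ ≡ 1 → ∣ error ∣ ≤ ℕ→ℚ (1 ℕ.* (i ℕ.^ 2))
  ∣error∣≤i² b₂≤b₁ det =
    [ (λ right → subst (_≤ ℕ→ℚ (1 ℕ.* (i ℕ.^ 2))) (cong ∣_∣ (sym (error-right right)))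
        (∣ℕ→ℚ-ℕ→ℚ∣≤ 1≤i² (E-≤ b₂≤b₁ 0)))
    , (λ left → subst (_≤ ℕ→ℚ (1 ℕ.* (i ℕ.^ 2))) (sym (trans (cong ∣_∣ (error-left left)) (ℚ.∣-p∣≡∣p∣ _)))
        (∣ℕ→ℚ-ℕ→ℚ∣≤ (ℕ.≤-trans (slice-0-≤1 b₁ b₂ q L 1 q0+1≤1+L) 1≤i²) (E-≤ b₂≤b₁ 1)))
    ]′ (∣m-n∣≡1 (a₁ ℕ.* b₂) (a₂ ℕ.* b₁) det)
    where
    q0+1≤1+L : q ℕ.* 0 ℕ.+ 1 ℕ.≤ suc L
    q0+1≤1+L = subst (λ y → y ℕ.+ 1 ℕ.≤ suc L) (sym (ℕ.*-zeroʳ q)) (s≤s z≤n)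

I-1/q : ∀ q L i .{{_ : NonZero q}} .{{_ : NonZero i}} → L ℕ.< q ℕ.* suc i → q ℕ.* i ℕ.≤ L →
        (∀ {j} → j ℕ.< i → suc j ∣ L) →
        ℕ→ℚ (I (1 ℕ.* L) (+ 1 / q)) ≡ ℕ→ℚ 2 + ℕ→ℚ (1 ℕ.* L) * ∑φ/j i - ℕ→ℚ q * ℕ→ℚ (Φ i)
I-1/q q L i L<q[1+i] qi≤L ∣L = begin
  ℕ→ℚ X
    ≡⟨ x≡2+w-f ⟩
  ℕ→ℚ 2 + ℕ→ℚ (W L i) - ℕ→ℚ (q ℕ.* Φ i)
    ≡⟨ cong₂ (λ w f → ℕ→ℚ 2 + w - f)
         (trans (sym (L*∑φ/j L i ∣L)) (cong (λ n → ℕ→ℚ n * ∑φ/j i) (sym (ℕ.*-identityˡ L)))) (ℕ→ℚ-* q (Φ i)) ⟩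
  ℕ→ℚ 2 + ℕ→ℚ (1 ℕ.* L) * ∑φ/j i - ℕ→ℚ q * ℕ→ℚ (Φ i) ∎
  where
  open ≡-Reasoning
  instance
    1q+0≢0 : NonZero (1 ℕ.* q ℕ.+ 0)
    1q+0≢0 = m*n+k≢0 1 q 0
    N≢0 : NonZero (1 ℕ.* L)
    N≢0 = ℕ.>-nonZero (ℕ.≤-trans (ℕ.>-nonZero⁻¹ (q ℕ.* i) {{m*n≢0 q i}}) (ℕ.≤-trans qi≤L (ℕ.m≤m+n L 0)))
  X = I (1 ℕ.* L) (+ 1 / q)
  E = ∑ i (λ j → excess 1 0 q L 0 (suc j))
  -- Since b₂ = 0, the condition k ≤ N reads u ≤ L, so no point is lost.
  E≡0 : E ≡ 0
  E≡0 = ℕ.n≤0⇒n≡0 (∑excess-≤ 1 0 q L i qi≤L ∣L 0 0 z≤n z≤n)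
  1/q : + 1 / q ≡ + (0 ℕ.* q ℕ.+ 1) / (1 ℕ.* q ℕ.+ 0)
  1/q = ℚ./-cong {+ 1} {q} {+ 1} refl (sym (trans (ℕ.+-identityʳ _) (ℕ.*-identityˡ q)))
  balanced : X ℕ.+ 0 ℕ.+ q ℕ.* Φ i ≡ 1 ℕ.+ W L i ℕ.+ 1
  balanced = begin
    X ℕ.+ 0 ℕ.+ q ℕ.* Φ i
      ≡⟨ cong₂ (λ y e → I (1 ℕ.* L) y ℕ.+ e ℕ.+ q ℕ.* Φ i) 1/q (sym E≡0) ⟩
    I (1 ℕ.* L) (+ (0 ℕ.* q ℕ.+ 1) / (1 ℕ.* q ℕ.+ 0)) ℕ.+ E ℕ.+ q ℕ.* Φ i
      -- The pair 0/1, 1/0 satisfies the mediant condition 0 + 1 ≤ 1 + 0 with equality, and its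
      -- determinant is +1.
      ≡⟨ I-right-balance 0 1 1 0 q L i z≤n ℕ.≤-refl L<q[1+i] qi≤L ∣L refl ⟩
    I (1 ℕ.* L) (+ 0 / 1) ℕ.+ W L i ℕ.+ 1
      ≡⟨ cong (λ y → y ℕ.+ W L i ℕ.+ 1) (I-0 (1 ℕ.* L)) ⟩
    1 ℕ.+ W L i ℕ.+ 1 ∎
  x≡2+w-f : ℕ→ℚ X ≡ ℕ→ℚ 2 + ℕ→ℚ (W L i) - ℕ→ℚ (q ℕ.* Φ i)
  x≡2+w-f = trans (restore (ℕ→ℚ X) (ℕ→ℚ (W L i)) (ℕ→ℚ (q ℕ.* Φ i)))
           (trans (cong (_+ (1ℚ + (ℕ→ℚ (W L i) - ℕ→ℚ (q ℕ.* Φ i)))) (balance X 0 (q ℕ.* Φ i) 1 (W L i) 1 balanced))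
                  (collect (ℕ→ℚ (W L i)) (ℕ→ℚ (q ℕ.* Φ i))))
    where
    open +-*-Solver
    restore : ∀ x w f → x ≡ (x - (1ℚ + (w - f))) + (1ℚ + (w - f))
    restore = solve 3 (λ x w f → x := (x :- (con 1ℚ :+ (w :- f))) :+ (con 1ℚ :+ (w :- f))) refl
    collect : ∀ w f → (1ℚ - ℕ→ℚ 0) + (1ℚ + (w - f)) ≡ ℕ→ℚ 2 + w - f
    collect = solve 2 (λ w f → (con 1ℚ :- con (ℕ→ℚ 0)) :+ (con 1ℚ :+ (w :- f)) := con (ℕ→ℚ 2) :+ w :- f) refl

theorem3p3 :
  ∃[ C ] ∀ (a₁ b₁ a₂ b₂ iₘₐₓ i N q : ℕ)
    .{{_ : NonZero b₁}} .{{_ : NonZero iₘₐₓ}} .{{_ : NonZero i}} .{{_ : NonZero q}} →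
    let instance b₁[i+1]≢0 = m*n≢0 b₁ (suc i)
        instance b₁i≢0     = m*n≢0 b₁ i
        instance b₁q+b₂≢0  = m*n+k≢0 b₁ q b₂
    in
    FareyPair a₁ b₁ a₂ b₂ →
    b₂ ℕ.< b₁ →
    i ℕ.< iₘₐₓ →
    N ≡ b₁ ℕ.* lcmUpTo iₘₐₓ →
    + N / (b₁ ℕ.* suc i) < ℕ→ℚ q →
    ℕ→ℚ q ≤ + N / (b₁ ℕ.* i) →
    (1 ℕ.< b₁ →
      ∣ ℕ→ℚ (I N (+ (a₁ ℕ.* q ℕ.+ a₂) / (b₁ ℕ.* q ℕ.+ b₂)))
        - (ℕ→ℚ (I N (+ a₁ / b₁))
           + sign a₁ b₁ a₂ b₂ * ((+ N / b₁) * ∑φ/j i - ℕ→ℚ q * ℕ→ℚ (Φ i))) ∣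
      ≤ ℕ→ℚ (C ℕ.* (i ℕ.^ 2)))
    × (a₁ ≡ 0 → b₁ ≡ 1 → a₂ ≡ 1 → b₂ ≡ 0 →
      ℕ→ℚ (I N (+ 1 / q)) ≡ ℕ→ℚ 2 + ℕ→ℚ N * ∑φ/j i - ℕ→ℚ q * ℕ→ℚ (Φ i))
theorem3p3 = 1 , λ a₁ b₁ a₂ b₂ iₘₐₓ i N q pair b₂<b₁ i<iₘₐₓ → λ where
  refl N/b₁[i+1]<q q≤N/b₁i →
    let L = lcmUpTo iₘₐₓ
        L<q[1+i] = q-lower-bound b₁ i L q N/b₁[i+1]<q
        qi≤L = q-upper-bound b₁ i L q q≤N/b₁i
        ∣L = λ {j} (j<i : j ℕ.< i) → suc∣lcmUpTo iₘₐₓ (ℕ.<-trans j<i i<iₘₐₓ)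
    in
    (λ 1<b₁ →
      let a₁≤b₁ , a₂≤b₂ , det = regular-pair pair 1<b₁
      in ∣error∣≤i² a₁ a₂ b₁ b₂ q L i a₁≤b₁ (ℕ.+-mono-≤ a₁≤b₁ a₂≤b₂) L<q[1+i] qi≤L ∣L (ℕ.<⇒≤ b₂<b₁) det) ,
    λ { refl refl refl refl → I-1/q q L i L<q[1+i] qi≤L ∣L }
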